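{- Let $G$ be a graphical cake represented by a finite connected graph of radius $r$, let two agents $A,B$ have valuations $v_A,v_B$ on $G$, and let $0\le t\le 1$ with entitlement vector $(t,1-t)$. Then there exists a weighted consensus division $(\alpha,\beta)$ of $G$ such that each of $\alpha$ and $\beta$ has at most $r+2$ connected components.
   Context: A graphical cake represented by a finite graph $G=(V,E)$ (loops and multiple edges allowed) consists of $|E|$ closed intervals, one per edge, with endpoints identified according to the incidence structure of $G$. A piece is a finite union of subintervals of edges; its connected pieces are its path components under the endpoint identifications. The radius of a connected graph is $\min_{v}\max_{w}d(v,w)$, with $d$ the graph distance. A valuation is a non-atomic Borel probability measure on the cake. A division between two agents is a pair of pieces $(\alpha,\beta)$ with $\alpha\cup\beta=G$ and $\alpha\cap\beta$ finite. Given entitlements $(t,1-t)$, $0\le t\le1$, a division is a weighted consensus division if $v_A(\alpha)=v_B(\alpha)=t$ and $v_A(\beta)=v_B(\beta)=1-t$. -}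

module Defs where

open import Algebra.Bundles using (CommutativeRing)
import Algebra.Properties.Ring as RingProperties
open import Data.Fin.Base using (Fin)
open import Data.List.Base using (List)
open import Data.List.Relation.Unary.Any using (Any)
open import Data.Nat.Base as ℕ using (ℕ; zero; suc)
open import Data.Product.Base using (Σ; ∃; _×_; _,_; proj₁; proj₂)
open import Data.Sum.Base using (_⊎_; inj₁; inj₂)
open import Function.Bundles using (_⇔_)
open import Level using (0ℓ) renaming (suc to lsuc)
open import Relation.Binary.Core using (Rel)
open import Relation.Binary.Definitions using (_Respects_)
open import Relation.Binary.PropositionalEquality.Core using (_≡_; _≢_)
open import Relation.Binary.Structures using (IsTotalOrder)
import Relation.Binary.Construct.NonStrictToStrict as Strict
open import Relation.Nullary.Negation.Core using (¬_)
open import Relation.Unary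
  using (Pred; Satisfiable; Universal; Empty; _∈_; _⊆_; _≐_; _⊥_; _∪_; _∩_; ∁; ⋃)

------------------------------------------------------------------------
-- Real numbers

-- The reals are axiomatised as a Dedekind-complete ordered field, which
-- classically determines them up to isomorphism.
record CompleteOrderedField : Set₁ where
  infix 4 _≤_
  field
    commutativeRing : CommutativeRing 0ℓ 0ℓ

  open CommutativeRing commutativeRing public

  field
    _≤_          : Rel Carrier 0ℓ
    isTotalOrder : IsTotalOrder _≈_ _≤_
    0≉1          : ¬ (0# ≈ 1#)
    inverse      : ∀ x → ¬ (x ≈ 0#) → ∃ λ y → x * y ≈ 1#
    +-monoʳ-≤    : ∀ z {x y} → x ≤ y → z + x ≤ z + y
    *-nonNeg     : ∀ {x y} → 0# ≤ x → 0# ≤ y → 0# ≤ x * y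

  IsUpperBound : Pred Carrier 0ℓ → Pred Carrier 0ℓ
  IsUpperBound S b = ∀ x → x ∈ S → x ≤ b

  field
    complete : ∀ (S : Pred Carrier 0ℓ) → Satisfiable S → Satisfiable (IsUpperBound S) →
               ∃ λ s → IsUpperBound S s × (∀ b → IsUpperBound S b → s ≤ b)

  open IsTotalOrder isTotalOrder public
    using (total; antisym; ≤-respˡ-≈; ≤-respʳ-≈)
    renaming (refl to ≤-refl; trans to ≤-trans; reflexive to ≤-reflexive)
  open Strict _≈_ _≤_ public using (_<_)

  0≤1 : 0# ≤ 1#
  0≤1 with total 0# 1#
  ... | inj₁ p = p
  ... | inj₂ 1≤0 = ≤-respʳ-≈ -1*-1≈1 (*-nonNeg 0≤-1 0≤-1)
    where
    open RingProperties ring using (-1*x≈-x; -‿involutive)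
    0≤-1 : 0# ≤ - 1#
    0≤-1 = ≤-respˡ-≈ (-‿inverseˡ 1#)
             (≤-respʳ-≈ (+-identityʳ (- 1#)) (+-monoʳ-≤ (- 1#) 1≤0))
    -1*-1≈1 : - 1# * - 1# ≈ 1#
    -1*-1≈1 = trans (-1*x≈-x (- 1#)) (-‿involutive 1#)

  -- |x - y| < ε
  Close : Carrier → Carrier → Carrier → Set
  Close ε x y = (x - ε < y) × (y < x + ε)

  partialSum : (ℕ → Carrier) → ℕ → Carrier
  partialSum f zero    = 0#
  partialSum f (suc n) = partialSum f n + f n

  _SumsTo_ : (ℕ → Carrier) → Carrier → Set
  f SumsTo s = ∀ ε → 0# < ε → ∃ λ N → ∀ n → N ℕ.≤ n → Close ε s (partialSum f n)

  -- The unit interval; equality of its points is _≈_ on the first component.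
  𝕀 : Set
  𝕀 = ∃ λ x → 0# ≤ x × x ≤ 1#

  0𝕀 1𝕀 : 𝕀
  0𝕀 = 0# , ≤-refl , 0≤1
  1𝕀 = 1# , 0≤1 , ≤-refl

  Open𝕀 : Pred 𝕀 0ℓ → Set
  Open𝕀 U = ∀ x → x ∈ U →
    ∃ λ ε → 0# < ε × (∀ y → Close ε (proj₁ x) (proj₁ y) → y ∈ U)

  -- Subintervals of [0,1], of any type (open, closed, half-open,
  -- degenerate), are its order-convex subsets.
  IsSubinterval : Pred 𝕀 0ℓ → Set
  IsSubinterval I = ∀ {x y z} → x ∈ I → z ∈ I →
    proj₁ x ≤ proj₁ y → proj₁ y ≤ proj₁ z → y ∈ I

------------------------------------------------------------------------
-- Finite multigraphs

-- The order src/tgt only fixes a parametrisation of each edge; the graph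
-- is undirected.  Loops and parallel edges are allowed.
record Graph : Set where
  field
    #V #E   : ℕ
    src tgt : Fin #E → Fin #V

IsMinimum IsMaximum : Pred ℕ 0ℓ → Pred ℕ 0ℓ
IsMinimum P m = m ∈ P × (∀ n → n ∈ P → m ℕ.≤ n)
IsMaximum P m = m ∈ P × (∀ n → n ∈ P → n ℕ.≤ m)

module _ (G : Graph) where
  open Graph G

  data Walk (u : Fin #V) : Fin #V → ℕ → Set where
    nil  : Walk u u 0
    fwd  : ∀ {k} e → Walk u (src e) k → Walk u (tgt e) (suc k)
    bwd  : ∀ {k} e → Walk u (tgt e) k → Walk u (src e) (suc k)

  Connected : Set
  Connected = Fin #V × (∀ u v → ∃ (Walk u v))

  IsDistance : Fin #V → Fin #V → ℕ → Set
  IsDistance u v = IsMinimum (Walk u v)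

  IsEccentricity : Fin #V → ℕ → Set
  IsEccentricity v = IsMaximum (λ d → ∃ λ w → IsDistance v w d)

  IsRadius : ℕ → Set
  IsRadius = IsMinimum (λ e → ∃ λ v → IsEccentricity v e)

------------------------------------------------------------------------
-- Graphical cakes

module Cake (ℝ : CompleteOrderedField) (G : Graph) where
  open CompleteOrderedField ℝ
  open Graph G

  Point : Set
  Point = Fin #E × 𝕀

  AtVertex : Point → Fin #V → Set
  AtVertex (e , x , _) v = (x ≈ 0# × src e ≡ v) ⊎ (x ≈ 1# × tgt e ≡ v)

  -- Equality of points of the cake: it is the quotient of Point by _∼_.
  infix 4 _∼_
  _∼_ : Rel Point 0ℓ
  p ∼ q = (proj₁ p ≡ proj₁ q × proj₁ (proj₂ p) ≈ proj₁ (proj₂ q))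
        ⊎ (∃ λ v → AtVertex p v × AtVertex q v)

  -- The quotient topology.
  Open : Pred Point 0ℓ → Set
  Open U = (U Respects _∼_) × (∀ e → Open𝕀 (λ x → U (e , x)))

  -- Open sets are unions of _∼_-classes, hence (classically) so is every
  -- Borel set.
  data Borel : Pred Point 0ℓ → Set₁ where
    open-set   : ∀ {U} → Open U → Borel U
    complement : ∀ {A} → Borel A → Borel (∁ A)
    union      : ∀ {A : ℕ → Pred Point 0ℓ} → (∀ i → Borel (A i)) → Borel (⋃ ℕ A)
    resp       : ∀ {A B} → A ≐ B → Borel A → Borel B

  BorelSet : Set₁
  BorelSet = ∃ Borel

  ⟦_⟧ : BorelSet → Pred Point 0ℓ
  ⟦_⟧ = proj₁

  ⋃ᴮ : (ℕ → BorelSet) → BorelSet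
  ⋃ᴮ A = ⋃ ℕ (λ i → ⟦ A i ⟧) , union (λ i → proj₂ (A i))

  record Valuation : Set₁ where
    field
      μ        : BorelSet → Carrier
      μ-cong   : ∀ A B → ⟦ A ⟧ ≐ ⟦ B ⟧ → μ A ≈ μ B
      nonNeg   : ∀ A → 0# ≤ μ A
      empty    : ∀ A → Empty ⟦ A ⟧ → μ A ≈ 0#
      additive : ∀ (A : ℕ → BorelSet) → (∀ i j → i ≢ j → ⟦ A i ⟧ ⊥ ⟦ A j ⟧) →
                 (λ i → μ (A i)) SumsTo μ (⋃ᴮ A)
      whole    : ∀ A → Universal ⟦ A ⟧ → μ A ≈ 1#

    IsAtom : BorelSet → Set₁
    IsAtom A = (0# < μ A) × (∀ B → ⟦ B ⟧ ⊆ ⟦ A ⟧ → (μ B ≈ 0#) ⊎ (μ B ≈ μ A))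

    field
      nonAtomic : ∀ A → ¬ IsAtom A

  Subinterval : Set₁
  Subinterval = Fin #E × Σ (Pred 𝕀 0ℓ) IsSubinterval

  -- Membership in the image of a subinterval in the quotient.
  _∈ˢ_ : Point → Subinterval → Set
  p ∈ˢ (e , I , _) = ∃ λ x → x ∈ I × (e , x) ∼ p

  IsPiece : Pred Point 0ℓ → Set₁
  IsPiece α = ∃ λ (Is : List Subinterval) → ∀ p → p ∈ α ⇔ Any (p ∈ˢ_) Is

  FiniteSet : Pred Point 0ℓ → Set
  FiniteSet α = ∃ λ (ps : List Point) → ∀ p → p ∈ α → Any (p ∼_) ps

  record IsDivision (α β : Pred Point 0ℓ) : Set₁ where
    field
      pieceˡ  : IsPiece α
      pieceʳ  : IsPiece β
      covers  : Universal (α ∪ β)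
      finite  : FiniteSet (α ∩ β)

  -- Pieces are Borel; taking α and β as Borel sets only makes their values
  -- expressible.
  record IsWeightedConsensusDivision
      (v-A v-B : Valuation) (t : Carrier) (α β : BorelSet) : Set₁ where
    open Valuation
    field
      isDivision : IsDivision ⟦ α ⟧ ⟦ β ⟧
      A-left     : μ v-A α ≈ t
      B-left     : μ v-B α ≈ t
      A-right    : μ v-A β ≈ 1# - t
      B-right    : μ v-B β ≈ 1# - t

  record Path (α : Pred Point 0ℓ) (p q : Point) : Set₁ where
    field
      γ          : 𝕀 → Point
      γ-cong     : ∀ x y → proj₁ x ≈ proj₁ y → γ x ∼ γ y
      continuous : ∀ U → Open U → Open𝕀 (λ x → U (γ x))
      inside     : ∀ x → γ x ∈ α
      start      : γ 0𝕀 ∼ p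
      end        : γ 1𝕀 ∼ q

  -- An injection of the set of path components of α into Fin k.
  AtMostComponents : ℕ → Pred Point 0ℓ → Set₁
  AtMostComponents k α =
    ∃ λ (component : ∀ p → p ∈ α → Fin k) →
      ∀ p q (p∈α : p ∈ α) (q∈α : q ∈ α) →
        component p p∈α ≡ component q q∈α ⇔ Path α p q

{-# OPTIONS --safe #-}

-- Take a spanning tree of shortest paths from a centre of G, hang every other edge on it as a
-- pendant edge, and number the edges in depth-first order, so that every point p of the cake has
-- a real height: the number of its edge plus the distance already travelled along it. For each
-- agent, the value of the points below height s is a continuous distribution function of s, and
-- the universal chord theorem yields heights a ≤ b such that both agents give the points between
-- a and b the value t, or both give them the value 1 - t. These points form one piece, and the
-- points below a or above b the other. Walking from a point of a piece towards the centre, one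
-- either arrives there or is stopped by the cut at an edge f; for given depth of f, there is only
-- one edge at which this happens. As depths range over 0 … r, there are at most r + 2 components.
module Submission where

open import Defs
open import Algebra.Bundles using (RawRing)
import Algebra.Properties.CommutativeSemigroup as CommutativeSemigroupProperties
import Algebra.Properties.Ring as RingProperties
import Algebra.Properties.Semiring.Mult as Mult
import Algebra.Solver.Ring as RingSolver
open import Algebra.Solver.Ring.AlmostCommutativeRing
  using (fromCommutativeRing; _-Raw-AlmostCommutative⟶_)
open import Axiom.ExcludedMiddle using (ExcludedMiddle)
open import Data.Bool.Base using (Bool; true; false; if_then_else_)
open import Data.Empty using (⊥-elim)
open import Data.Fin.Base as Fin using (Fin; toℕ)
import Data.Fin.Properties as Fin
open import Data.List.Base as List using (List; []; _∷_; _++_)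
open import Data.List.Relation.Unary.Any using (Any; here; there)
import Data.List.Relation.Unary.Any.Properties as Any
open import Data.Maybe.Base using (Maybe; just; nothing)
open import Data.Nat.Base as ℕ using (ℕ; zero; suc; z≤n; s≤s)
open import Data.Nat.Induction using (<-rec)
import Data.Nat.Properties as ℕ
open import Data.Product.Base as Product using (∃; ∃₂; _×_; _,_; proj₁; proj₂; swap)
open import Data.Sum.Base as Sum using (_⊎_; inj₁; inj₂)

open import Function.Base using (_∘_; id)
open import Function.Bundles using (mk⇔; Equivalence)
open import Level using (0ℓ)
open import Relation.Binary.Bundles using (Setoid)
open import Relation.Binary.PropositionalEquality.Core as ≡ using (_≡_; _≢_)
import Relation.Binary.Reasoning.Setoid as SetoidReasoning
open import Relation.Nullary.Decidable.Core using (yes; no; decidable-stable)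
open import Relation.Nullary.Negation.Core using (¬_; contradiction)
open import Relation.Unary
  using (Pred; Satisfiable; Universal; _∈_; _∉_; _⊆_; _⊥_; _∪_; _∩_; ∁; ⋃; ∅)

-- Ring identities

-- The alternative between `t` and `1 - t` is that of the universal chord theorem itself: a function
-- vanishing at both ends of [0 , T] need not have a horizontal chord of given length `ℓ`, but it
-- has one of length `ℓ` or one of length `T - ℓ`. Depth-first order reserves a block of consecutive
-- ranks for the subtree on an edge, disjoint from the other blocks at the same depth. If the walk
-- towards the centre is stopped by a cut at `f`, the cut lies in the block of `f`; this is why the
-- depth of `f` determines `f`. There are `r + 1` depths, because an edge may hang from a vertex at
-- distance `r`, and the centre supplies the last of the `r + 2` labels. In the outer piece, all
-- points below `a` are joined to the centre and share its label. Two obstacles: height is not a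
-- function on the cake, since the edge ends meeting at a vertex have different heights; and it
-- jumps between an edge and its parent, so that a cut may fall between the two. Hence pieces are
-- saturations of sets given by heights, values are computed inside the edges, vertices being null,
-- and a walk may stop at the head of an edge as well as on it.

module Solver (ℝ : CompleteOrderedField) where
  open CompleteOrderedField ℝ hiding (zero)
  open RingProperties ring
  open Mult semiring using (×-homo-+; ×1-homo-*) renaming (_×_ to _·_)
  open SetoidReasoning setoid

  -- The pair (m , n) stands for the integer m - n. The solver compares normal forms
  -- syntactically, so coefficients have to be kept reduced.
  cancel : ℕ × ℕ → ℕ × ℕ
  cancel (suc a , suc b) = cancel (a , b)
  cancel z               = z

  integers : RawRing 0ℓ 0ℓ
  integers = record
    { Carrier = ℕ × ℕ
    ; _≈_     = _≡_
    ; _+_     = λ (a , b) (c , d) → cancel (a ℕ.+ c , b ℕ.+ d)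
    ; _*_     = λ (a , b) (c , d) → cancel (a ℕ.* c ℕ.+ b ℕ.* d , a ℕ.* d ℕ.+ b ℕ.* c)
    ; -_      = λ (a , b) → b , a
    ; 0#      = 0 , 0
    ; 1#      = 1 , 0
    }

  difference : ℕ × ℕ → Carrier
  difference (a , b) = a · 1# - b · 1#

  -- `(0 , 0)` and `(1 , 0)` are singled out so that the constants `:0` and `:1` evaluate to `0#`
  -- and `1#` themselves, as they occur in goals; `difference (1 , 0)` would be `1# + 0# - 0#`.
  embed : ℕ × ℕ → Carrier
  embed (0 , 0) = 0#
  embed (1 , 0) = 1#
  embed z       = difference z

  embed≈difference : ∀ z → embed z ≈ difference z
  embed≈difference (0 , 0)           = sym (-‿inverseʳ 0#)
  embed≈difference (0 , suc _)       = refl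
  embed≈difference (1 , 0)           = sym (trans (+-cong (+-identityʳ 1#) -0#≈0#) (+-identityʳ 1#))
  embed≈difference (1 , suc _)       = refl
  embed≈difference (suc (suc _) , _) = refl

  open CommutativeSemigroupProperties +-commutativeSemigroup using (interchange)

  neg-difference : ∀ x y → - (x - y) ≈ y - x
  neg-difference x y = begin
    - (x - y)   ≈⟨ -‿+-comm x (- y) ⟨
    - x - - y   ≈⟨ +-congˡ (-‿involutive y) ⟩
    - x + y     ≈⟨ +-comm (- x) y ⟩
    y - x       ∎

  +-difference : ∀ x y z w → (x - y) + (z - w) ≈ (x + z) - (y + w)
  +-difference x y z w = begin
    (x - y) + (z - w)       ≈⟨ interchange x (- y) z (- w) ⟩
    (x + z) + (- y - w)     ≈⟨ +-congˡ (-‿+-comm y w) ⟩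
    (x + z) - (y + w)       ∎

  *-difference : ∀ x y z w → (x - y) * (z - w) ≈ (x * z + y * w) - (x * w + y * z)
  *-difference x y z w = begin
    (x - y) * (z - w)                     ≈⟨ [y-z]x≈yx-zx (z - w) x y ⟩
    x * (z - w) - y * (z - w)             ≈⟨ +-cong (x[y-z]≈xy-xz x z w) (-‿cong (x[y-z]≈xy-xz y z w)) ⟩
    (x * z - x * w) - (y * z - y * w)     ≈⟨ +-congˡ (neg-difference (y * z) (y * w)) ⟩
    (x * z - x * w) + (y * w - y * z)     ≈⟨ +-difference (x * z) (x * w) (y * w) (y * z) ⟩
    (x * z + y * w) - (x * w + y * z)     ∎

  difference-cong : ∀ a b c d → a ℕ.+ d ≡ c ℕ.+ b → difference (a , b) ≈ difference (c , d)
  difference-cong a b c d eq = begin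
    a′ - b′                   ≈⟨ +-identityʳ _ ⟨
    (a′ - b′) + 0#            ≈⟨ +-congˡ (-‿inverseʳ d′) ⟨
    (a′ - b′) + (d′ - d′)     ≈⟨ +-difference a′ b′ d′ d′ ⟩
    (a′ + d′) - (b′ + d′)     ≈⟨ +-cong (trans (sym (×-homo-+ 1# a d)) (trans (reflexive (≡.cong (_· 1#) eq)) (×-homo-+ 1# c b))) (-‿cong (+-comm b′ d′)) ⟩
    (c′ + b′) - (d′ + b′)     ≈⟨ +-difference c′ d′ b′ b′ ⟨
    (c′ - d′) + (b′ - b′)     ≈⟨ +-congˡ (-‿inverseʳ b′) ⟩
    (c′ - d′) + 0#            ≈⟨ +-identityʳ _ ⟩
    c′ - d′                   ∎
    where
    a′ b′ c′ d′ : Carrier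
    a′ = a · 1#
    b′ = b · 1#
    c′ = c · 1#
    d′ = d · 1#

  embed-cancel : ∀ z → embed (cancel z) ≈ difference z
  embed-cancel (suc a , suc b)     = trans (embed-cancel (a , b))
                                           (difference-cong a b (suc a) (suc b) (ℕ.+-suc a b))
  embed-cancel (0 , b)             = embed≈difference (0 , b)
  embed-cancel (suc a , 0)         = embed≈difference (suc a , 0)

  morphism : integers -Raw-AlmostCommutative⟶ fromCommutativeRing commutativeRing
  morphism = record
    { ⟦_⟧    = embed
    ; +-homo = λ { z@(a , b) w@(c , d) → begin
        embed (cancel (a ℕ.+ c , b ℕ.+ d))                    ≈⟨ embed-cancel (a ℕ.+ c , b ℕ.+ d) ⟩
        difference (a ℕ.+ c , b ℕ.+ d)                        ≈⟨ +-cong (×-homo-+ 1# a c) (-‿cong (×-homo-+ 1# b d)) ⟩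
        (a · 1# + c · 1#) - (b · 1# + d · 1#)                 ≈⟨ +-difference _ _ _ _ ⟨
        difference z + difference w                           ≈⟨ +-cong (embed≈difference z) (embed≈difference w) ⟨
        embed z + embed w                                     ∎ }
    ; *-homo = λ { z@(a , b) w@(c , d) → begin
        embed (cancel (a ℕ.* c ℕ.+ b ℕ.* d , a ℕ.* d ℕ.+ b ℕ.* c)) ≈⟨ embed-cancel (a ℕ.* c ℕ.+ b ℕ.* d , a ℕ.* d ℕ.+ b ℕ.* c) ⟩
        difference (a ℕ.* c ℕ.+ b ℕ.* d , a ℕ.* d ℕ.+ b ℕ.* c) ≈⟨ +-cong (homo a c b d) (-‿cong (homo a d b c)) ⟩
        (a · 1# * c · 1# + b · 1# * d · 1#) - (a · 1# * d · 1# + b · 1# * c · 1#) ≈⟨ *-difference _ _ _ _ ⟨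
        difference z * difference w                           ≈⟨ *-cong (embed≈difference z) (embed≈difference w) ⟨
        embed z * embed w                                     ∎ }
    ; -‿homo = λ { z@(a , b) → begin
        embed (b , a)    ≈⟨ embed≈difference (b , a) ⟩
        difference (b , a) ≈⟨ neg-difference _ _ ⟨
        - difference z   ≈⟨ -‿cong (embed≈difference z) ⟨
        - embed z        ∎ }
    ; 0-homo = refl
    ; 1-homo = refl
    }
    where
    homo : ∀ a b c d → (a ℕ.* b ℕ.+ c ℕ.* d) · 1# ≈ a · 1# * b · 1# + c · 1# * d · 1#
    homo a b c d = trans (×-homo-+ 1# (a ℕ.* b) (c ℕ.* d)) (+-cong (×1-homo-* a b) (×1-homo-* c d))

  _coeff≟_ : ∀ z w → Maybe (embed z ≈ embed w)
  (a , b) coeff≟ (c , d) with a ℕ.+ d ℕ.≟ c ℕ.+ b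
  ... | no  _  = nothing
  ... | yes eq = just (trans (embed≈difference (a , b))
                      (trans (difference-cong a b c d eq) (sym (embed≈difference (c , d)))))

  open RingSolver integers (fromCommutativeRing commutativeRing) morphism _coeff≟_ public
    using (Polynomial; con; solve; _:=_; _:+_; _:*_; _:-_; :-_)

  :0 :1 : ∀ {n} → Polynomial n
  :0 = con (0 , 0)
  :1 = con (1 , 0)

-- Ordered fields

module OrderedField (em : ∀ {ℓ} → ExcludedMiddle ℓ) (ℝ : CompleteOrderedField) where
  open CompleteOrderedField ℝ hiding (zero)
  open Solver ℝ using (solve; _:=_; _:+_; _:*_; _:-_; :-_; :0; :1)
  open RingProperties ring using (-‿involutive)

  infixl 6 _⊕_ _⊕<_ _⊕≈_

  abstract
    _⊕_ : ∀ {a b c d} → a ≤ b → c ≤ d → a + c ≤ b + d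
    _⊕_ {a} {b} {c} {d} p q = ≤-trans (+-monoʳ-≤ a q)
      (≤-respˡ-≈ (+-comm d a) (≤-respʳ-≈ (+-comm d b) (+-monoʳ-≤ d p)))

    _⊕≈_ : ∀ {a b c d} → a ≈ b → c ≈ d → a + c ≈ b + d
    _⊕≈_ = +-cong

    shift : ∀ a b c d → d - c ≈ b - a → c + (b - a) ≈ d
    shift a b c d eq = trans (+-congˡ (sym eq)) (solve 2 (λ a b → a :+ (b :- a) := b) refl _ _)

    -- Linear arithmetic: p is the sum of the hypotheses used, and the equation is left to the solver.
    lin : ∀ {a b c d} → a ≤ b → d - c ≈ b - a → c ≤ d
    lin {a} {b} {c} {d} p eq = ≤-respˡ-≈ (ringʳ a c) (≤-respʳ-≈ (trans (ringˡ a b c) (shift a b c d eq)) (+-monoʳ-≤ (c - a) p))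
      where
      ringʳ : ∀ a c → c - a + a ≈ c
      ringʳ a c = solve 2 (λ a b → a :- b :+ b := a) refl _ _
      ringˡ : ∀ a b c → c - a + b ≈ c + (b - a)
      ringˡ a b c = solve 3 (λ a b c → a :- b :+ c := a :+ (c :- b)) refl _ _ _

    lin≈ : ∀ {a b c d} → a ≈ b → d - c ≈ b - a → c ≈ d
    lin≈ {a} {b} {c} {d} p eq = antisym (lin (≤-reflexive p) eq) (lin (≤-reflexive (sym p)) (trans (flip c d) (trans (-‿cong eq) (sym (flip a b)))))
      where
      flip : ∀ x y → x - y ≈ - (y - x)
      flip x y = solve 2 (λ a b → a :- b := :- (b :- a)) refl _ _

    lin< : ∀ {a b c d} → a < b → d - c ≈ b - a → c < d
    lin< {a} {b} {c} {d} (p , a≉b) eq = lin p eq , λ c≈d → a≉b (lin≈ c≈d (sym eq))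

    _⊕<_ : ∀ {a b c d} → a < b → c ≤ d → a + c < b + d
    _⊕<_ {a} {b} {c} {d} (p , a≉b) q = p ⊕ q , λ eq →
      a≉b (antisym p (lin (≤-reflexive (sym eq) ⊕ q) (eq′ a b c d)))
      where
      eq′ : ∀ a b c d → a - b ≈ (a + c + d) - (b + d + c)
      eq′ a b c d = solve 4 (λ a b c d → a :- b := a :+ c :+ d :- (b :+ d :+ c)) refl _ _ _ _

    <-irrefl : ∀ {a b} → a < b → ¬ (a ≈ b)
    <-irrefl = proj₂

    <⇒≱ : ∀ {x y} → x < y → ¬ (y ≤ x)
    <⇒≱ (x≤y , x≉y) y≤x = x≉y (antisym x≤y y≤x)

    ≰⇒> : ∀ {x y} → ¬ (x ≤ y) → y < x
    ≰⇒> {x} {y} x≰y with total x y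
    ... | inj₁ x≤y = contradiction x≤y x≰y
    ... | inj₂ y≤x = y≤x , λ y≈x → x≰y (≤-reflexive (sym y≈x))

    compare : ∀ x y → x ≤ y ⊎ y < x
    compare x y with em {P = x ≤ y}
    ... | yes x≤y = inj₁ x≤y
    ... | no  x≰y = inj₂ (≰⇒> x≰y)

    <-≤-trans : ∀ {x y z} → x < y → y ≤ z → x < z
    <-≤-trans {x} {y} {z} p q = lin< (p ⊕< q)
      (solve 3 (λ a b c → a :- b := c :+ a :- (b :+ c)) refl _ _ _)

    ≤-<-trans : ∀ {x y z} → x ≤ y → y < z → x < z
    ≤-<-trans {x} {y} {z} p q = lin< (q ⊕< p)
      (solve 3 (λ a b c → a :- b := a :+ c :- (c :+ b)) refl _ _ _)

    0<1 : 0# < 1#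
    0<1 = 0≤1 , 0≉1

    half : ∃ λ h → h + h ≈ 1#
    half = h , trans (double h) eq
      where
      2≉0 : ¬ (1# + 1# ≈ 0#)
      2≉0 eq = <-irrefl (0<1 ⊕< 0≤1) (trans (+-identityˡ 0#) (sym eq))
      h : Carrier
      h = proj₁ (inverse (1# + 1#) 2≉0)
      eq : (1# + 1#) * h ≈ 1#
      eq = proj₂ (inverse (1# + 1#) 2≉0)
      double : ∀ x → x + x ≈ (1# + 1#) * x
      double x = solve 1 (λ a → a :+ a := (:1 :+ :1) :* a) refl _

    ½ : Carrier
    ½ = proj₁ half

    ½+½≈1 : ½ + ½ ≈ 1#
    ½+½≈1 = proj₂ half

    halves : ∀ x → x * ½ + x * ½ ≈ x
    halves x = trans (sym (distribˡ x ½ ½)) (trans (*-congˡ ½+½≈1) (*-identityʳ x))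

    -- Positivity is argued by doubling, with no sign of `½` at hand: `ε * ½ ≤ 0#`, added to itself,
    -- gives `ε ≤ 0#`.
    halve : ∀ {ε} → 0# < ε → ∃ λ η → 0# < η × η + η ≈ ε
    halve {ε} 0<ε = ε * ½ , ≰⇒> (λ η≤0 → <⇒≱ 0<ε (lin (η≤0 ⊕ η≤0 ⊕ ≤-reflexive (sym (halves ε)))
      (solve 2 (λ a b → :0 :- a := :0 :+ :0 :+ (a :* b :+ a :* b) :- (a :* b :+ a :* b :+ a)) refl _ _))) , halves ε

    smaller : ∀ {a b} → 0# < a → 0# < b → ∃ λ c → 0# < c × c ≤ a × c ≤ b
    smaller {a} {b} 0<a 0<b with total a b
    ... | inj₁ a≤b = a , 0<a , ≤-refl , a≤b
    ... | inj₂ b≤a = b , 0<b , b≤a , ≤-refl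

    positive : ∀ {x y} → x < y → 0# < y - x
    positive x<y = lin< x<y (solve 2 (λ a b → a :- b :- :0 := a :- b) refl _ _)

  abstract
    approx-cong : ∀ {ε x y z w} → x ≈ y → z ≈ w → y - ε < z → x - ε < w
    approx-cong x≈y z≈w y-ε<z = lin< (y-ε<z ⊕< ≤-reflexive x≈y ⊕< ≤-reflexive z≈w)
      (solve 5 (λ a b c d e → a :- (b :- c) := d :+ e :+ a :- (e :- c :+ b :+ d)) refl _ _ _ _ _)

  -- Suprema, intermediate values and maxima

  IsSupremum : Pred Carrier 0ℓ → Pred Carrier 0ℓ
  IsSupremum S s = IsUpperBound S s × (∀ b → IsUpperBound S b → s ≤ b)

  abstract
    sup-approx : ∀ {S s} → IsSupremum S s → ∀ y → y < s → ∃ λ x → x ∈ S × y < x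
    sup-approx {S} {s} (_ , least) y y<s with em {P = ∃ λ x → x ∈ S × y < x}
    ... | yes found = found
    ... | no  none  = contradiction (least y bound) (<⇒≱ y<s)
      where
      bound : IsUpperBound S y
      bound x x∈S with compare x y
      ... | inj₁ x≤y = x≤y
      ... | inj₂ y<x = contradiction (x , x∈S , y<x) none

  Monotone : (Carrier → Carrier) → Set
  Monotone f = ∀ {x y} → x ≤ y → f x ≤ f y

  -- For a monotone function a single point `s′` suffices, since the values between `s′` and `s` are
  -- squeezed. Continuity of a measure along an increasing sequence of sets produces exactly such a
  -- point.
  LeftContinuous RightContinuous : (Carrier → Carrier) → Set
  LeftContinuous  f = ∀ s ε → 0# < ε → ∃ λ s′ → s′ < s × f s - ε < f s′
  RightContinuous f = ∀ s ε → 0# < ε → ∃ λ s′ → s < s′ × f s′ < f s + ε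

  opaque
    -- At the supremum `s` of the points where `f` is at most `τ`, left continuity excludes
    -- `τ < f s` and right continuity excludes `f s < τ`.
    monotone-ivt : ∀ {f} → Monotone f → LeftContinuous f → RightContinuous f →
                   ∀ {lo hi τ} → lo ≤ hi → f lo ≤ τ → τ ≤ f hi → ∃ λ s → f s ≈ τ
    monotone-ivt {f} mono left right {lo} {hi} {τ} lo≤hi flo≤τ τ≤fhi =
      let s , sup = complete S (lo , lo≤hi , flo≤τ) (hi , λ _ → proj₁)
      in s , antisym (fs≤τ s sup) (τ≤fs s sup)
      where
      S : Pred Carrier 0ℓ
      S x = x ≤ hi × f x ≤ τ

      module _ (s : Carrier) (sup : IsSupremum S s) where
        fs≤τ : f s ≤ τ
        fs≤τ with compare (f s) τ
        ... | inj₁ fs≤τ = fs≤τ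
        ... | inj₂ τ<fs with left s (f s - τ) (positive τ<fs)
        ...   | s′ , s′<s , close with sup-approx sup s′ s′<s
        ...     | x , (_ , fx≤τ) , s′<x = ⊥-elim (<-irrefl (close ⊕< fx≤τ ⊕< mono (proj₁ s′<x))
          (solve 4 (λ a b c d → a :- (a :- b) :+ c :+ d := d :+ b :+ c) refl _ _ _ _))

        τ≤fs : τ ≤ f s
        τ≤fs with compare τ (f s)
        ... | inj₁ τ≤fs = τ≤fs
        ... | inj₂ fs<τ with right s (τ - f s) (positive fs<τ)
        ...   | s′ , s<s′ , close with total s′ hi
        ...     | inj₁ s′≤hi = contradiction (proj₁ sup s′ (s′≤hi , lin (proj₁ close)
          (solve 3 (λ a b c → a :- b := c :+ (a :- c) :- b) refl _ _ _))) (<⇒≱ s<s′)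
        ...     | inj₂ hi≤s′ = ⊥-elim (<-irrefl (close ⊕< τ≤fhi ⊕< mono hi≤s′)
          (solve 4 (λ a b c d → a :+ b :+ c := d :+ (b :- d) :+ c :+ a) refl _ _ _ _))

  -- The constant is 1, and the absolute value is split into two inequalities. As `f` is a bare
  -- function on a setoid, this bound is also what makes it respect `_≈_` on the interval.
  Lipschitz : Carrier → Carrier → (Carrier → Carrier) → Set
  Lipschitz p q f = ∀ {x y} → p ≤ x → x ≤ y → y ≤ q → f y - f x ≤ y - x × f x - f y ≤ y - x

  -- The constant is 2, as for the difference `f (x + ℓ) - f x` when `f` has constant 1.
  DoublyLipschitz : Carrier → Carrier → (Carrier → Carrier) → Set
  DoublyLipschitz p q f = ∀ {x y} → p ≤ x → x ≤ y → y ≤ q →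
    f y - f x ≤ (y - x) + (y - x) × f x - f y ≤ (y - x) + (y - x)

  opaque
    -- At the supremum `s` of the points where `f` is nonnegative, suppose that `f s` is off zero by
    -- `η + η`. Then `f` cannot change sign within distance `η` of `s`, against the choice of `s`.
    ivt : ∀ {f p q} → DoublyLipschitz p q f → p ≤ q → 0# ≤ f p → f q ≤ 0# →
          ∃ λ s → p ≤ s × s ≤ q × f s ≈ 0#
    ivt {f} {p} {q} lip p≤q 0≤fp fq≤0 =
      let s , sup = complete S (p , p∈S) (q , S≤q) in root s sup
      where
      S : Pred Carrier 0ℓ
      S x = p ≤ x × x ≤ q × 0# ≤ f x

      p∈S : S p
      p∈S = ≤-refl , p≤q , 0≤fp

      S≤q : IsUpperBound S q
      S≤q _ (_ , x≤q , _) = x≤q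

      module _ (s : Carrier) (sup : IsSupremum S s) where
        p≤s : p ≤ s
        p≤s = proj₁ sup p p∈S

        s≤q : s ≤ q
        s≤q = proj₂ sup q S≤q

        0≤fs : 0# ≤ f s
        0≤fs with compare 0# (f s)
        ... | inj₁ 0≤fs = 0≤fs
        ... | inj₂ fs<0 with halve (positive fs<0)
        ...   | η , 0<η , η+η≈-fs with sup-approx sup (s - η) (lin< 0<η
          (solve 2 (λ a b → a :- (a :- b) := b :- :0) refl _ _))
        ...     | x , x∈S@(p≤x , x≤q , 0≤fx) , s-η<x = ⊥-elim (<-irrefl
          (s-η<x ⊕< proj₁ s-η<x ⊕< proj₂ (lip p≤x (proj₁ sup x x∈S) s≤q) ⊕< 0≤fx ⊕< ≤-reflexive η+η≈-fs)
          (solve 5 (λ a b c d e → a :- b :+ (a :- b) :+ (c :- d) :+ :0 :+ (b :+ b) := e :+ e :+ (a :- e :+ (a :- e)) :+ c :+ (:0 :- d)) refl _ _ _ _ _))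

        root : ∃ λ s → p ≤ s × s ≤ q × f s ≈ 0#
        root with compare (f s) 0#
        ... | inj₁ fs≤0 = s , p≤s , s≤q , antisym fs≤0 0≤fs
        ... | inj₂ 0<fs with halve 0<fs
        ...   | η , 0<η , η+η≈fs with total q (s + η)
        -- Within distance `η` of `s`, `f` is still nonnegative; together with `fq≤0` this makes `q`
        -- itself a root.
        ...     | inj₁ q≤s+η = q , p≤q , ≤-refl , antisym fq≤0
          (lin (q≤s+η ⊕ q≤s+η ⊕ proj₂ (lip p≤s s≤q ≤-refl) ⊕ ≤-reflexive η+η≈fs)
            (solve 5 (λ a b c d e → a :- :0 := b :+ c :+ (b :+ c) :+ (d :- b :+ (d :- b)) :+ e :- (d :+ d :+ (e :- a) :+ (c :+ c))) refl _ _ _ _ _))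
        ...     | inj₂ s+η≤q = contradiction (proj₁ sup (s + η) s+η∈S) (<⇒≱ (lin< 0<η
          (solve 2 (λ a b → a :+ b :- a := b :- :0) refl _ _)))
          where
          s≤s+η : s ≤ s + η
          s≤s+η = lin (proj₁ 0<η) (solve 2 (λ a b → a :+ b :- a := b :- :0) refl _ _)
          s+η∈S : S (s + η)
          s+η∈S = ≤-trans p≤s s≤s+η , s+η≤q ,
            lin (proj₂ (lip p≤s s≤s+η s+η≤q) ⊕ ≤-reflexive η+η≈fs)
              (solve 4 (λ a b c d → a :- :0 := b :+ c :- b :+ (b :+ c :- b) :+ d :- (d :- a :+ (c :+ c))) refl _ _ _ _)

    -- The Lipschitz bound makes the values bounded, so they have a supremum `M`; a second supremum,
    -- over positions, finds a point where it is attained.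
    argmax : ∀ {f T} → 0# ≤ T → Lipschitz 0# T f →
             ∃ λ σ → 0# ≤ σ × σ ≤ T × (∀ {x} → 0# ≤ x → x ≤ T → f x ≤ f σ)
    argmax {f} {T} 0≤T lip =
      let M , sup-f = complete Range (f 0# , f0∈Range) (f 0# + T , bounded)
          σ , sup   = complete (S M sup-f) (0# , 0∈S M sup-f) (T , S≤T M sup-f)
      in σ , 0≤σ M sup-f σ sup , σ≤T M sup-f σ sup , λ 0≤x x≤T →
         ≤-trans (proj₁ sup-f _ (_ , 0≤x , x≤T , refl)) (M≤fσ M sup-f σ sup)
      where
      Range : Pred Carrier 0ℓ
      Range m = ∃ λ x → 0# ≤ x × x ≤ T × f x ≈ m

      f0∈Range : Range (f 0#)
      f0∈Range = 0# , ≤-refl , 0≤T , refl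

      bounded : IsUpperBound Range (f 0# + T)
      bounded m (x , 0≤x , x≤T , fx≈m) =
        lin (proj₁ (lip ≤-refl 0≤x x≤T) ⊕ x≤T ⊕ ≤-reflexive (sym fx≈m))
          (solve 5 (λ a b c d e → a :+ b :- c := d :- :0 :+ b :+ e :- (e :- a :+ d :+ c)) refl _ _ _ _ _)

      module _ (M : Carrier) (sup-f : IsSupremum Range M) where

        -- The supremum of these points is the rightmost point at which f attains M.
        S : Pred Carrier 0ℓ
        S x = 0# ≤ x × x ≤ T × (∀ {m} → m < M → ∃ λ y → x ≤ y × y ≤ T × m < f y)

        0∈S : S 0#
        0∈S = ≤-refl , 0≤T , λ m<M →
          let _ , (x , 0≤x , x≤T , fx≈y) , m<y = sup-approx sup-f _ m<M
          in x , 0≤x , x≤T , <-≤-trans m<y (≤-reflexive (sym fx≈y))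

        S≤T : IsUpperBound S T
        S≤T _ (_ , x≤T , _) = x≤T

        module _ (σ : Carrier) (sup : IsSupremum S σ) where

          0≤σ : 0# ≤ σ
          0≤σ = proj₁ sup 0# 0∈S

          σ≤T : σ ≤ T
          σ≤T = proj₂ sup T S≤T

          -- If `f σ` fell short of `M` by `η + η`, no value above `M - η` would be taken within
          -- distance `η` of `σ`. A point of `S` just left of `σ` has such values to its right,
          -- hence at or beyond `σ + η`; then `σ + η` would belong to `S`.
          M≤fσ : M ≤ f σ
          M≤fσ with compare M (f σ)
          ... | inj₁ M≤fσ = M≤fσ
          ... | inj₂ fσ<M with halve (positive fσ<M)
          ...   | η , 0<η , η+η≈M-fσ with sup-approx sup (σ - η) (lin< 0<η
            (solve 2 (λ a b → a :- (a :- b) := b :- :0) refl _ _))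
          ...     | x , (0≤x , x≤T , near) , σ-η<x =
            contradiction (proj₁ sup (σ + η) σ+η∈S) (<⇒≱ (lin< 0<η
              (solve 2 (λ a b → a :+ b :- a := b :- :0) refl _ _)))
            where
            far : ∀ {y} → x ≤ y → y ≤ T → M - η < f y → σ + η ≤ y
            far {y} x≤y y≤T high with total (σ + η) y | total σ y
            ... | inj₁ σ+η≤y | _ = σ+η≤y
            ... | inj₂ y≤σ+η | inj₁ σ≤y = ⊥-elim (<-irrefl
              (high ⊕< proj₁ (lip 0≤σ σ≤y y≤T) ⊕< y≤σ+η ⊕< ≤-reflexive η+η≈M-fσ)
                (solve 6 (λ a b c d e f → a :- b :+ (c :- d) :+ e :+ (b :+ b) := c :+ (e :- f) :+ (f :+ b) :+ (a :- d)) refl _ _ _ _ _ _))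
            ... | _ | inj₂ y≤σ = ⊥-elim (<-irrefl
              (high ⊕< proj₂ (lip (≤-trans 0≤x x≤y) y≤σ σ≤T) ⊕< x≤y ⊕< proj₁ σ-η<x ⊕< ≤-reflexive η+η≈M-fσ)
                (solve 7 (λ a b c d e f g → a :- b :+ (c :- d) :+ e :+ (f :- b) :+ (b :+ b) := c :+ (f :- g) :+ g :+ e :+ (a :- d)) refl _ _ _ _ _ _ _))

            M-η<M : M - η < M
            M-η<M = lin< 0<η (solve 2 (λ a b → a :- (a :- b) := b :- :0) refl _ _)

            near′ : ∀ {m} → m < M → ∃ λ y → σ + η ≤ y × y ≤ T × m < f y
            near′ {m} m<M with total m (M - η)
            ... | inj₁ m≤M-η = let y , x≤y , y≤T , high = near M-η<M
                               in y , far x≤y y≤T high , y≤T , ≤-<-trans m≤M-η high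
            ... | inj₂ M-η≤m = let y , x≤y , y≤T , high = near m<M
                               in y , far x≤y y≤T (≤-<-trans M-η≤m high) , y≤T , high

            σ+η∈S : S (σ + η)
            σ+η∈S = let y , σ+η≤y , y≤T , _ = near′ M-η<M
                    in lin (0≤σ ⊕ proj₁ 0<η)
                            (solve 2 (λ a b → a :+ b :- :0 := a :+ b :- (:0 :+ :0)) refl _ _) ,
                            ≤-trans σ+η≤y y≤T , near′

-- Universal chords

module ConsensusCut (em : ∀ {ℓ} → ExcludedMiddle ℓ) (ℝ : CompleteOrderedField) where
  open CompleteOrderedField ℝ hiding (zero)
  open OrderedField em ℝ
  open Solver ℝ using (solve; _:=_; _:+_; _:*_; _:-_; :-_; :0; :1)

  Chord : Carrier → (Carrier → Carrier) → Carrier → Set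
  Chord T f ℓ = ∃ λ σ → 0# ≤ σ × σ + ℓ ≤ T × f (σ + ℓ) ≈ f σ

  module _ {f : Carrier → Carrier} {T : Carrier} (lip : Lipschitz 0# T f) where

    lipschitz-neg : Lipschitz 0# T (λ x → - f x)
    lipschitz-neg 0≤x x≤y y≤T = let up , down = lip 0≤x x≤y y≤T in lin down
            (solve 4 (λ a b c d → a :- b :- (:- c :- (:- d)) := a :- b :- (d :- c)) refl _ _ _ _) ,
            lin up
            (solve 4 (λ a b c d → a :- b :- (:- c :- (:- d)) := a :- b :- (d :- c)) refl _ _ _ _)

    lipschitz-cong : ∀ {x y} → 0# ≤ x → y ≤ T → x ≈ y → f x ≈ f y
    lipschitz-cong 0≤x y≤T x≈y =
      let up , down = lip 0≤x (≤-reflexive x≈y) y≤T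
      in antisym (lin (down ⊕ ≤-reflexive (sym x≈y))
              (solve 4 (λ a b c d → a :- b := c :- d :+ d :- (b :- a :+ c)) refl _ _ _ _))
              (lin (up ⊕ ≤-reflexive (sym x≈y))
              (solve 4 (λ a b c d → a :- b := c :- d :+ d :- (b :- a :+ c)) refl _ _ _ _))

    -- Intermediate value theorem for `f (x + ℓ) - f x`, as a window of length `ℓ` slides from `0#`
    -- to `w`.
    crossing : ∀ {ℓ w} → 0# ≤ ℓ → 0# ≤ w → w + ℓ ≤ T →
               f 0# ≤ f (0# + ℓ) → f (w + ℓ) ≤ f w → Chord T f ℓ
    crossing {ℓ} {w} 0≤ℓ 0≤w w+ℓ≤T rise fall =
      chord (ivt {λ x → f (x + ℓ) - f x} {0#} {w} lip-shift 0≤w (lin rise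
        (solve 2 (λ a b → a :- b :- :0 := a :- b) refl _ _))
        (lin fall (solve 2 (λ a b → :0 :- (a :- b) := b :- a) refl _ _)))
      where
      chord : (∃ λ σ → 0# ≤ σ × σ ≤ w × f (σ + ℓ) - f σ ≈ 0#) → Chord T f ℓ
      chord (σ , 0≤σ , σ≤w , root) = σ , 0≤σ , lin (σ≤w ⊕ w+ℓ≤T)
        (solve 4 (λ a b c d → a :- (b :+ c) := d :+ a :- (b :+ (d :+ c))) refl _ _ _ _) ,
        lin≈ root (solve 2 (λ a b → a :- b := :0 :- (b :- a)) refl _ _)

      lip-shift : DoublyLipschitz 0# w (λ x → f (x + ℓ) - f x)
      lip-shift {x} {y} 0≤x x≤y y≤w =
        let up  , down  = lip 0≤x x≤y (lin (y≤w ⊕ 0≤ℓ ⊕ w+ℓ≤T)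
                (solve 4 (λ a b c d → a :- b := c :+ d :+ a :- (b :+ :0 :+ (c :+ d))) refl _ _ _ _))
            up′ , down′ = lip {x + ℓ} {y + ℓ} (lin (0≤x ⊕ 0≤ℓ)
                    (solve 2 (λ a b → a :+ b :- :0 := a :+ b :- (:0 :+ :0)) refl _ _))
                    (lin x≤y
                    (solve 3 (λ a b c → a :+ b :- (c :+ b) := a :- c) refl _ _ _))
                    (lin (y≤w ⊕ w+ℓ≤T)
                    (solve 4 (λ a b c d → a :- (b :+ c) := d :+ a :- (b :+ (d :+ c))) refl _ _ _ _))
        in lin (up′ ⊕ down)
                (solve 7 (λ a b c d e f g → a :- b :+ (a :- b) :- (c :- d :- (e :- f)) := a :+ g :- (b :+ g) :+ (a :- b) :- (c :- e :+ (f :- d))) refl _ _ _ _ _ _ _) ,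
                lin (down′ ⊕ up)
                (solve 7 (λ a b c d e f g → a :- b :+ (a :- b) :- (c :- d :- (e :- f)) := a :+ g :- (b :+ g) :+ (a :- b) :- (c :- e :+ (f :- d))) refl _ _ _ _ _ _ _)

  crossing⁻ : ∀ {f T} → Lipschitz 0# T f → ∀ {ℓ w} → 0# ≤ ℓ → 0# ≤ w → w + ℓ ≤ T →
              f (0# + ℓ) ≤ f 0# → f w ≤ f (w + ℓ) → Chord T f ℓ
  crossing⁻ {f} {T} lip {ℓ} {w} 0≤ℓ 0≤w w+ℓ≤T fall rise =
    chord (crossing {λ x → - f x} {T} (lipschitz-neg {f} lip) {ℓ} {w} 0≤ℓ 0≤w w+ℓ≤T (lin fall
      (solve 2 (λ a b → :- a :- (:- b) := b :- a) refl _ _))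
      (lin rise (solve 2 (λ a b → :- a :- (:- b) := b :- a) refl _ _)))
    where
    chord : Chord T (λ x → - f x) ℓ → Chord T f ℓ
    chord (σ , 0≤σ , σ+ℓ≤T , eq) = σ , 0≤σ , σ+ℓ≤T , lin≈ (sym eq)
      (solve 2 (λ a b → a :- b := :- b :- (:- a)) refl _ _)

  module _ {f : Carrier → Carrier} {T : Carrier}
           (lip : Lipschitz 0# T f) (f0≈0 : f 0# ≈ 0#) (fT≈0 : f T ≈ 0#)
           {ℓ ℓ′ : Carrier} (0≤ℓ : 0# ≤ ℓ) (0≤ℓ′ : 0# ≤ ℓ′) (ℓ+ℓ′≈T : ℓ + ℓ′ ≈ T) where
    private
      ℓ≤T : 0# + ℓ ≤ T
      ℓ≤T = lin (0≤ℓ′ ⊕ ≤-reflexive ℓ+ℓ′≈T)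
        (solve 3 (λ a b c → a :- (:0 :+ b) := c :+ a :- (:0 :+ (b :+ c))) refl _ _ _)

      0≤ : 0# ≤ 0# + ℓ
      0≤ = lin 0≤ℓ (solve 1 (λ a → :0 :+ a :- :0 := a :- :0) refl _)

      start : f (0# + ℓ) ≈ f ℓ
      start = lipschitz-cong {f} lip 0≤ (lin ℓ≤T
        (solve 2 (λ a b → a :- b := a :- (:0 :+ b)) refl _ _)) (solve 1 (λ a → :0 :+ a := a) refl _)

      finish : f (ℓ′ + ℓ) ≈ f T
      finish = lipschitz-cong {f} lip (lin (0≤ℓ ⊕ 0≤ℓ′)
        (solve 2 (λ a b → a :+ b :- :0 := b :+ a :- (:0 :+ :0)) refl _ _))
        ≤-refl (lin≈ ℓ+ℓ′≈T (solve 3 (λ a b c → a :- (b :+ c) := a :- (c :+ b)) refl _ _ _))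

    -- The first window of length `ℓ` starts at `0#` and the last at `ℓ′`. As `f` vanishes at both
    -- ends, the sign of `f ℓ` tells whether `f` rises over the first, and that of `f ℓ′` whether it
    -- falls over the last.
    chord-≥0 : 0# ≤ f ℓ → 0# ≤ f ℓ′ → Chord T f ℓ
    chord-≥0 0≤fℓ 0≤fℓ′ = crossing {f} lip 0≤ℓ 0≤ℓ′ (lin (≤-reflexive ℓ+ℓ′≈T)
      (solve 3 (λ a b c → a :- (b :+ c) := a :- (c :+ b)) refl _ _ _))
      (lin (0≤fℓ ⊕ ≤-reflexive f0≈0 ⊕ ≤-reflexive (sym start))
        (solve 3 (λ a b c → a :- b := c :+ :0 :+ a :- (:0 :+ b :+ c)) refl _ _ _))
      (lin (0≤fℓ′ ⊕ ≤-reflexive fT≈0 ⊕ ≤-reflexive finish)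
        (solve 3 (λ a b c → a :- b := a :+ :0 :+ c :- (:0 :+ c :+ b)) refl _ _ _))

    chord-≤0 : f ℓ ≤ 0# → f ℓ′ ≤ 0# → Chord T f ℓ
    chord-≤0 fℓ≤0 fℓ′≤0 = crossing⁻ {f} lip 0≤ℓ 0≤ℓ′ (lin (≤-reflexive ℓ+ℓ′≈T)
      (solve 3 (λ a b c → a :- (b :+ c) := a :- (c :+ b)) refl _ _ _))
      (lin (fℓ≤0 ⊕ ≤-reflexive (sym f0≈0) ⊕ ≤-reflexive start)
        (solve 3 (λ a b c → a :- b := :0 :+ a :+ c :- (c :+ :0 :+ b)) refl _ _ _))
      (lin (fℓ′≤0 ⊕ ≤-reflexive (sym fT≈0) ⊕ ≤-reflexive (sym finish))
        (solve 3 (λ a b c → a :- b := :0 :+ c :+ a :- (b :+ :0 :+ c)) refl _ _ _))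

    -- At a maximum τ of f, one of f (τ + ℓ) ≤ f τ and f (τ - ℓ′) ≤ f τ makes sense.
    chord-mixed : 0# ≤ f ℓ → f ℓ′ ≤ 0# → Chord T f ℓ ⊎ Chord T f ℓ′
    chord-mixed 0≤fℓ fℓ′≤0 with argmax {f} (lin (0≤ℓ ⊕ 0≤ℓ′ ⊕ ≤-reflexive ℓ+ℓ′≈T)
      (solve 3 (λ a b c → a :- :0 := b :+ c :+ a :- (:0 :+ :0 :+ (b :+ c))) refl _ _ _)) lip
    ... | τ , 0≤τ , τ≤T , max with total τ ℓ′
    ...   | inj₁ τ≤ℓ′ = inj₁ (crossing {f} lip 0≤ℓ 0≤τ τ+ℓ≤T
      (lin (0≤fℓ ⊕ ≤-reflexive f0≈0 ⊕ ≤-reflexive (sym start))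
        (solve 3 (λ a b c → a :- b := c :+ :0 :+ a :- (:0 :+ b :+ c)) refl _ _ _))
      (max (lin (0≤τ ⊕ 0≤ℓ)
        (solve 2 (λ a b → a :+ b :- :0 := a :+ b :- (:0 :+ :0)) refl _ _)) τ+ℓ≤T))
      where
      τ+ℓ≤T : τ + ℓ ≤ T
      τ+ℓ≤T = lin (τ≤ℓ′ ⊕ ≤-reflexive ℓ+ℓ′≈T)
        (solve 4 (λ a b c d → a :- (b :+ c) := d :+ a :- (b :+ (c :+ d))) refl _ _ _ _)
    ...   | inj₂ ℓ′≤τ = inj₂ (crossing⁻ {f} lip {w = τ - ℓ′} 0≤ℓ′ (lin ℓ′≤τ
      (solve 2 (λ a b → a :- b :- :0 := a :- b) refl _ _))
      (lin τ≤T (solve 3 (λ a b c → a :- (b :- c :+ c) := a :- b) refl _ _ _))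
      (lin (fℓ′≤0 ⊕ ≤-reflexive (sym f0≈0) ⊕ ≤-reflexive start′)
        (solve 3 (λ a b c → a :- b := :0 :+ a :+ c :- (c :+ :0 :+ b)) refl _ _ _))
      (≤-trans (max (lin ℓ′≤τ
        (solve 2 (λ a b → a :- b :- :0 := a :- b) refl _ _))
        (lin (τ≤T ⊕ 0≤ℓ′) (solve 3 (λ a b c → a :- (b :- c) := a :+ c :- (b :+ :0)) refl _ _ _)))
               (≤-reflexive (lipschitz-cong {f} lip 0≤τ (lin τ≤T
                 (solve 3 (λ a b c → a :- (b :- c :+ c) := a :- b) refl _ _ _))
                 (solve 2 (λ a b → a := a :- b :+ b) refl _ _)))))
      where
      start′ : f (0# + ℓ′) ≈ f ℓ′
      start′ = lipschitz-cong {f} lip (lin 0≤ℓ′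
        (solve 1 (λ a → :0 :+ a :- :0 := a :- :0) refl _))
        (lin (0≤ℓ ⊕ ≤-reflexive ℓ+ℓ′≈T)
        (solve 3 (λ a b c → a :- b := c :+ a :- (:0 :+ (c :+ b))) refl _ _ _))
        (solve 1 (λ a → :0 :+ a := a) refl _)

  -- For `0# < ℓ`, a chord of length `ℓ` by itself is guaranteed only if `T` is an integer multiple
  -- of `ℓ`. When `f ℓ` and `f ℓ′` differ in sign, `f` rises over the first window of one length and
  -- falls over that of the other; a maximum of `f` provides the opposite window for one of them.
  universal-chord : ∀ {f T ℓ ℓ′} → Lipschitz 0# T f → f 0# ≈ 0# → f T ≈ 0# →
                    0# ≤ ℓ → 0# ≤ ℓ′ → ℓ + ℓ′ ≈ T → Chord T f ℓ ⊎ Chord T f ℓ′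
  universal-chord {f} {ℓ = ℓ} {ℓ′} lip f0≈0 fT≈0 0≤ℓ 0≤ℓ′ sum with total 0# (f ℓ) | total 0# (f ℓ′)
  ... | inj₁ p | inj₁ q = inj₁ (chord-≥0 {f} lip f0≈0 fT≈0 0≤ℓ 0≤ℓ′ sum p q)
  ... | inj₁ p | inj₂ q = chord-mixed {f} lip f0≈0 fT≈0 0≤ℓ 0≤ℓ′ sum p q
  ... | inj₂ p | inj₁ q = Sum.swap (chord-mixed {f} lip f0≈0 fT≈0 0≤ℓ′ 0≤ℓ (trans (+-comm ℓ′ ℓ) sum) q p)
  ... | inj₂ p | inj₂ q = inj₁ (chord-≤0 {f} lip f0≈0 fT≈0 0≤ℓ 0≤ℓ′ sum p q)

  double-injective : ∀ {x y} → x + x ≈ y + y → x ≈ y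
  double-injective {x} {y} eq = trans (sym (halves x)) (trans (sym (distribʳ ½ x x))
    (trans (*-congʳ eq) (trans (distribʳ ½ y y) (halves y))))

  -- Equal increments of two distribution functions

  record IsDistribution (F : Carrier → Carrier) : Set where
    field
      monotone   : Monotone F
      continuousˡ : LeftContinuous F
      continuousʳ : RightContinuous F
      0≤F        : ∀ s → 0# ≤ F s
      F≤1        : ∀ s → F s ≤ 1#

  Increments : (a b : Carrier → Carrier) → Carrier → Carrier → Carrier → Set
  Increments a b lo hi u = a hi - a lo ≈ u × b hi - b lo ≈ u

  -- Parametrise the curve (a , b) by a + b, over [0 , 2]; then a - b is 1-Lipschitz and vanishes
  -- at both ends, and its horizontal chords are the pairs of points where a and b grow equally.
  module _ {a b : Carrier → Carrier} (distA : IsDistribution a) (distB : IsDistribution b)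
           {lo hi : Carrier} (lo≤hi : lo ≤ hi)
           (a-lo : a lo ≈ 0#) (b-lo : b lo ≈ 0#) (a-hi : a hi ≈ 1#) (b-hi : b hi ≈ 1#) where
    private
      module DA = IsDistribution distA
      module DB = IsDistribution distB

      2# : Carrier
      2# = 1# + 1#

      c : Carrier → Carrier
      c s = a s + b s

      left : LeftContinuous c
      left s ε 0<ε with halve 0<ε
      ... | η , 0<η , η+η≈ε with DA.continuousˡ s η 0<η | DB.continuousˡ s η 0<η
      ...   | x , x<s , close | y , y<s , close′ with total x y
      ...     | inj₁ x≤y = y , y<s , lin< (close ⊕< proj₁ close′ ⊕< DA.monotone x≤y ⊕< ≤-reflexive η+η≈ε)
        (solve 7 (λ a b c d e f g → a :+ b :- (c :+ d :- e) := f :+ b :+ a :+ e :- (c :- g :+ (d :- g) :+ f :+ (g :+ g))) refl _ _ _ _ _ _ _)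
      ...     | inj₂ y≤x = x , x<s , lin< (close ⊕< proj₁ close′ ⊕< DB.monotone y≤x ⊕< ≤-reflexive η+η≈ε)
        (solve 7 (λ a b c d e f g → a :+ b :- (c :+ d :- e) := a :+ f :+ b :+ e :- (c :- g :+ (d :- g) :+ f :+ (g :+ g))) refl _ _ _ _ _ _ _)

      right : RightContinuous c
      right s ε 0<ε with halve 0<ε
      ... | η , 0<η , η+η≈ε with DA.continuousʳ s η 0<η | DB.continuousʳ s η 0<η
      ...   | x , s<x , close | y , s<y , close′ with total x y
      ...     | inj₁ x≤y = x , s<x , lin< (close ⊕< proj₁ close′ ⊕< DB.monotone x≤y ⊕< ≤-reflexive η+η≈ε)
        (solve 7 (λ a b c d e f g → a :+ b :+ c :- (d :+ e) := a :+ f :+ (b :+ f) :+ g :+ c :- (d :+ g :+ e :+ (f :+ f))) refl _ _ _ _ _ _ _)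
      ...     | inj₂ y≤x = y , s<y , lin< (close ⊕< proj₁ close′ ⊕< DA.monotone y≤x ⊕< ≤-reflexive η+η≈ε)
        (solve 7 (λ a b c d e f g → a :+ b :+ c :- (d :+ e) := a :+ f :+ (b :+ f) :+ g :+ c :- (g :+ e :+ d :+ (f :+ f))) refl _ _ _ _ _ _ _)

      level : ∀ τ → ∃ λ s → 0# ≤ τ → τ ≤ 2# → c s ≈ τ
      level τ with em {P = 0# ≤ τ × τ ≤ 2#}
      -- A default value outside [0 , 2], so that `at` and `f` are total functions.
      ... | no outside = 0# , λ 0≤τ τ≤2 → contradiction (0≤τ , τ≤2) outside
      ... | yes (0≤τ , τ≤2) =
        Product.map₂ (λ cs≈τ _ _ → cs≈τ)
          (monotone-ivt {c} (λ x≤y → DA.monotone x≤y ⊕ DB.monotone x≤y) left right lo≤hi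
            (lin (≤-reflexive a-lo ⊕ ≤-reflexive b-lo ⊕ 0≤τ)
              (solve 3 (λ a b c → a :- (b :+ c) := :0 :+ :0 :+ a :- (b :+ c :+ :0)) refl _ _ _))
            (lin (≤-reflexive (sym a-hi) ⊕ ≤-reflexive (sym b-hi) ⊕ τ≤2)
              (solve 3 (λ a b c → a :+ b :- c := a :+ b :+ (:1 :+ :1) :- (:1 :+ :1 :+ c)) refl _ _ _)))

      at : Carrier → Carrier
      at τ = proj₁ (level τ)

      at-sum : ∀ {τ} → 0# ≤ τ → τ ≤ 2# → a (at τ) + b (at τ) ≈ τ
      at-sum {τ} = proj₂ (level τ)

      f : Carrier → Carrier
      f τ = a (at τ) - b (at τ)

      -- If `s′` lies left of `s`, neither function can be larger there; as their sum is not
      -- smaller, neither summand is. A value of the sum thus determines both summands, whichever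
      -- point `level` has picked.
      order : ∀ {s s′} → c s ≤ c s′ → a s ≤ a s′ × b s ≤ b s′
      order {s} {s′} cs≤cs′ with total s s′
      ... | inj₁ s≤s′ = DA.monotone s≤s′ , DB.monotone s≤s′
      ... | inj₂ s′≤s = lin (cs≤cs′ ⊕ DB.monotone s′≤s)
        (solve 4 (λ a b c d → a :- b := a :+ c :+ d :- (b :+ d :+ c)) refl _ _ _ _) ,
        lin (cs≤cs′ ⊕ DA.monotone s′≤s)
        (solve 4 (λ a b c d → a :- b := c :+ a :+ d :- (d :+ b :+ c)) refl _ _ _ _)

      -- The increments of `a` and `b` are nonnegative and add up to `y - x`, so their difference is
      -- at most `y - x` in absolute value.
      lip : Lipschitz 0# 2# f
      lip {x} {y} 0≤x x≤y y≤2 =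
        lin (up-b ⊕ up-b ⊕ ≤-reflexive at-x ⊕ ≤-reflexive at-y)
          (solve 6 (λ a b c d e f → a :- b :- (c :- d :- (e :- f)) := d :+ d :+ (e :+ f) :+ a :- (f :+ f :+ b :+ (c :+ d))) refl _ _ _ _ _ _) ,
        lin (up-a ⊕ up-a ⊕ ≤-reflexive at-x ⊕ ≤-reflexive at-y)
          (solve 6 (λ a b c d e f → a :- b :- (c :- d :- (e :- f)) := e :+ e :+ (c :+ d) :+ a :- (c :+ c :+ b :+ (e :+ f))) refl _ _ _ _ _ _)
        where
        at-x : x ≈ a (at x) + b (at x)
        at-x = sym (at-sum 0≤x (≤-trans x≤y y≤2))
        at-y : a (at y) + b (at y) ≈ y
        at-y = at-sum (≤-trans 0≤x x≤y) y≤2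
        ups : a (at x) ≤ a (at y) × b (at x) ≤ b (at y)
        ups = order (lin (x≤y ⊕ ≤-reflexive (sym at-x) ⊕ ≤-reflexive (sym at-y))
                (solve 6 (λ a b c d e f → a :+ b :- (c :+ d) := e :+ f :+ (a :+ b) :- (f :+ (c :+ d) :+ e)) refl _ _ _ _ _ _))
        up-a : a (at x) ≤ a (at y)
        up-a = proj₁ ups
        up-b : b (at x) ≤ b (at y)
        up-b = proj₂ ups

      0≤2 : 0# ≤ 2#
      0≤2 = lin (0≤1 ⊕ 0≤1) (solve 0 (:1 :+ :1 :- :0 := :1 :+ :1 :- (:0 :+ :0)) refl)

      f0≈0 : f 0# ≈ 0#
      f0≈0 = antisym (lin (DB.0≤F (at 0#) ⊕ DB.0≤F (at 0#) ⊕ ≤-reflexive sum)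
        (solve 2 (λ a b → :0 :- (a :- b) := b :+ b :+ :0 :- (:0 :+ :0 :+ (a :+ b))) refl _ _))
                     (lin (DA.0≤F (at 0#) ⊕ DA.0≤F (at 0#) ⊕ ≤-reflexive sum)
                       (solve 2 (λ a b → a :- b :- :0 := a :+ a :+ :0 :- (:0 :+ :0 :+ (a :+ b))) refl _ _))
        where
        sum : a (at 0#) + b (at 0#) ≈ 0#
        sum = at-sum ≤-refl 0≤2

      f2≈0 : f 2# ≈ 0#
      f2≈0 = antisym (lin (DA.F≤1 (at 2#) ⊕ DA.F≤1 (at 2#) ⊕ ≤-reflexive (sym sum))
        (solve 2 (λ a b → :0 :- (a :- b) := :1 :+ :1 :+ (a :+ b) :- (a :+ a :+ (:1 :+ :1))) refl _ _))
                     (lin (DB.F≤1 (at 2#) ⊕ DB.F≤1 (at 2#) ⊕ ≤-reflexive (sym sum))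
                       (solve 2 (λ a b → a :- b :- :0 := :1 :+ :1 :+ (a :+ b) :- (b :+ b :+ (:1 :+ :1))) refl _ _))
        where
        sum : a (at 2#) + b (at 2#) ≈ 1# + 1#
        sum = at-sum 0≤2 ≤-refl

      -- If the points come in the wrong order, monotonicity forces `u ≈ 0#`, and exchanging them
      -- does no harm.
      ordered : ∀ {u} → 0# ≤ u → ∀ {x y} → Increments a b x y u → ∃₂ λ x y → x ≤ y × Increments a b x y u
      ordered {u} 0≤u {x} {y} (Δa , Δb) with total x y
      ... | inj₁ x≤y = x , y , x≤y , Δa , Δb
      ... | inj₂ y≤x = y , x , y≤x , lin≈ (sym Δa ⊕≈ u≈0 ⊕≈ u≈0)
        (solve 3 (λ a b c → a :- (b :- c) := c :- b :+ a :+ a :- (a :+ :0 :+ :0)) refl _ _ _) ,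
        lin≈ (sym Δb ⊕≈ u≈0 ⊕≈ u≈0)
        (solve 3 (λ a b c → a :- (b :- c) := c :- b :+ a :+ a :- (a :+ :0 :+ :0)) refl _ _ _)
        where
        u≈0 : 0# ≈ u
        u≈0 = antisym 0≤u (lin (DA.monotone y≤x ⊕ ≤-reflexive (sym Δa))
          (solve 3 (λ a b c → :0 :- a := b :+ (c :- b) :- (c :+ a)) refl _ _ _))

      -- Along a chord of length `u + u` the sum of `a` and `b` grows by `u + u` and their
      -- difference not at all, so each of them grows by `u`.
      increments : ∀ {u} → 0# ≤ u → Chord 2# f (u + u) → ∃₂ λ x y → x ≤ y × Increments a b x y u
      increments {u} 0≤u (σ , 0≤σ , σ+2u≤2 , eq) = ordered 0≤u {at σ} {at (σ + (u + u))}
        (double-injective (lin≈ (eq ⊕≈ at-σ′ ⊕≈ sym at-σ)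
          (solve 6 (λ a b c d e f → a :+ a :- (b :- c :+ (b :- c)) := c :- d :+ (e :+ (a :+ a)) :+ (c :+ d) :- (b :- f :+ (b :+ f) :+ e)) refl _ _ _ _ _ _)) ,
         double-injective (lin≈ (sym eq ⊕≈ at-σ′ ⊕≈ sym at-σ)
           (solve 6 (λ a b c d e f → a :+ a :- (b :- c :+ (b :- c)) := d :- b :+ (e :+ (a :+ a)) :+ (f :+ c) :- (f :- c :+ (d :+ b) :+ e)) refl _ _ _ _ _ _)))
        where
        at-σ : a (at σ) + b (at σ) ≈ σ
        at-σ = at-sum 0≤σ (lin (0≤u ⊕ 0≤u ⊕ σ+2u≤2)
          (solve 2 (λ a b → :1 :+ :1 :- a := b :+ b :+ (:1 :+ :1) :- (:0 :+ :0 :+ (a :+ (b :+ b)))) refl _ _))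
        at-σ′ : a (at (σ + (u + u))) + b (at (σ + (u + u))) ≈ σ + (u + u)
        at-σ′ = at-sum (lin (0≤σ ⊕ 0≤u ⊕ 0≤u)
          (solve 2 (λ a b → a :+ (b :+ b) :- :0 := a :+ b :+ b :- (:0 :+ :0 :+ :0)) refl _ _)) σ+2u≤2

    consensus-cut : ∀ {t} → 0# ≤ t → t ≤ 1# →
                    ∃₂ λ x y → x ≤ y × (Increments a b x y t ⊎ Increments a b x y (1# - t))
    consensus-cut {t} 0≤t t≤1 = choose
      (universal-chord {f} {2#} {t + t} {(1# - t) + (1# - t)} lip f0≈0 f2≈0 (lin (0≤t ⊕ 0≤t)
        (solve 1 (λ a → a :+ a :- :0 := a :+ a :- (:0 :+ :0)) refl _))
        (lin (t≤1 ⊕ t≤1)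
        (solve 1 (λ a → :1 :- a :+ (:1 :- a) :- :0 := :1 :+ :1 :- (a :+ a)) refl _)) (complementary t))
      where
      complementary : ∀ t → (t + t) + ((1# - t) + (1# - t)) ≈ 1# + 1#
      complementary t = solve 1 (λ a → a :+ a :+ (:1 :- a :+ (:1 :- a)) := :1 :+ :1) refl _

      choose : Chord 2# f (t + t) ⊎ Chord 2# f ((1# - t) + (1# - t)) →
               ∃₂ λ x y → x ≤ y × (Increments a b x y t ⊎ Increments a b x y (1# - t))
      choose (inj₁ chord) = Product.map₂ (Product.map₂ (Product.map₂ inj₁)) (increments {t} 0≤t chord)
      choose (inj₂ chord) = Product.map₂ (Product.map₂ (Product.map₂ inj₂)) (increments {1# - t} (lin t≤1
        (solve 1 (λ a → :1 :- a :- :0 := :1 :- a) refl _)) chord)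

-- Measures on a cake

module CakeMeasure (em : ∀ {ℓ} → ExcludedMiddle ℓ) (ℝ : CompleteOrderedField) (G : Graph) where
  open CompleteOrderedField ℝ hiding (zero)
  open OrderedField em ℝ
  open Solver ℝ using (solve; _:=_; _:+_; _:*_; _:-_; :-_; :0; :1)
  open Graph G
  open Cake ℝ G

  ∼-refl : ∀ {p} → p ∼ p
  ∼-refl = inj₁ (≡.refl , refl)

  ∼-sym : ∀ {p q} → p ∼ q → q ∼ p
  ∼-sym (inj₁ (e≡e′ , x≈x′))  = inj₁ (≡.sym e≡e′ , sym x≈x′)
  ∼-sym (inj₂ (v , p-v , q-v)) = inj₂ (v , q-v , p-v)

  atVertex-cong : ∀ {e x y v} → proj₁ x ≈ proj₁ y → AtVertex (e , x) v → AtVertex (e , y) v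
  atVertex-cong x≈y (inj₁ (x≈0 , s)) = inj₁ (trans (sym x≈y) x≈0 , s)
  atVertex-cong x≈y (inj₂ (x≈1 , s)) = inj₂ (trans (sym x≈y) x≈1 , s)

  atVertex-unique : ∀ {p v w} → AtVertex p v → AtVertex p w → v ≡ w
  atVertex-unique (inj₁ (_ , a))   (inj₁ (_ , b))   = ≡.trans (≡.sym a) b
  atVertex-unique (inj₁ (x≈0 , _)) (inj₂ (x≈1 , _)) = contradiction (trans (sym x≈0) x≈1) 0≉1
  atVertex-unique (inj₂ (x≈1 , _)) (inj₁ (x≈0 , _)) = contradiction (trans (sym x≈0) x≈1) 0≉1
  atVertex-unique (inj₂ (_ , a))   (inj₂ (_ , b))   = ≡.trans (≡.sym a) b

  ∼-trans : ∀ {p q r} → p ∼ q → q ∼ r → p ∼ r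
  ∼-trans (inj₁ (≡.refl , a)) (inj₁ (≡.refl , b)) = inj₁ (≡.refl , trans a b)
  ∼-trans {_ , x} {_ , y} (inj₁ (≡.refl , a)) (inj₂ (v , q-v , r-v)) = inj₂ (v , atVertex-cong {x = y} {x} (sym a) q-v , r-v)
  ∼-trans {q = _ , x} {_ , y} (inj₂ (v , p-v , q-v)) (inj₁ (≡.refl , b)) = inj₂ (v , p-v , atVertex-cong {x = x} {y} b q-v)
  ∼-trans {q = q} {r} (inj₂ (v , p-v , q-v)) (inj₂ (w , q-w , r-w)) =
    inj₂ (v , p-v , ≡.subst (AtVertex r) (≡.sym (atVertex-unique {q} q-v q-w)) r-w)

  borel-saturated : ∀ {A} → Borel A → ∀ {p q} → p ∼ q → p ∈ A → q ∈ A
  borel-saturated (open-set (saturated , _)) p∼q p∈A       = saturated p∼q p∈A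
  borel-saturated (complement A) {p} {q} p∼q p∉A           = p∉A ∘ borel-saturated A (∼-sym {p} {q} p∼q)
  borel-saturated (union As) p∼q (i , p∈Ai)                = i , borel-saturated (As i) p∼q p∈Ai
  borel-saturated (resp (A⊆B , B⊆A) A) p∼q p∈B             = A⊆B (borel-saturated A p∼q (B⊆A p∈B))

  ∅ᴮ : BorelSet
  ∅ᴮ = ∅ , open-set ((λ _ ()) , λ _ _ ())

  ∁ᴮ : BorelSet → BorelSet
  ∁ᴮ (A , A-borel) = ∁ A , complement A-borel

  -- Padding with empty sets derives finite unions and finite additivity from the countable ones in
  -- `Borel` and `Valuation`.
  two : BorelSet → BorelSet → ℕ → BorelSet
  two A B 0             = A
  two A B 1             = B
  two A B (suc (suc _)) = ∅ᴮ

  _∪ᴮ_ _∖ᴮ_ : BorelSet → BorelSet → BorelSet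
  A ∪ᴮ B = ⟦ A ⟧ ∪ ⟦ B ⟧ , resp (to , from) (proj₂ (⋃ᴮ (two A B)))
    where
    to : ⟦ ⋃ᴮ (two A B) ⟧ ⊆ ⟦ A ⟧ ∪ ⟦ B ⟧
    to (0 , p∈A) = inj₁ p∈A
    to (1 , p∈B) = inj₂ p∈B
    from : ⟦ A ⟧ ∪ ⟦ B ⟧ ⊆ ⟦ ⋃ᴮ (two A B) ⟧
    from (inj₁ p∈A) = 0 , p∈A
    from (inj₂ p∈B) = 1 , p∈B
  A ∖ᴮ B = (λ p → p ∈ ⟦ A ⟧ × p ∉ ⟦ B ⟧) , resp (to , from) (proj₂ (∁ᴮ (∁ᴮ A ∪ᴮ B)))
    where
    to : ⟦ ∁ᴮ (∁ᴮ A ∪ᴮ B) ⟧ ⊆ (λ p → p ∈ ⟦ A ⟧ × p ∉ ⟦ B ⟧)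
    to ∉ = decidable-stable em (∉ ∘ inj₁) , ∉ ∘ inj₂
    from : (λ p → p ∈ ⟦ A ⟧ × p ∉ ⟦ B ⟧) ⊆ ⟦ ∁ᴮ (∁ᴮ A ∪ᴮ B) ⟧
    from (p∈A , _)   (inj₁ p∉A) = p∉A p∈A
    from (_   , p∉B) (inj₂ p∈B) = p∉B p∈B

  sumsTo-unique : ∀ {f s c} N → f SumsTo s → (∀ n → N ℕ.≤ n → partialSum f n ≈ c) → s ≈ c
  sumsTo-unique {f} {s} {c} N sums eventually = antisym s≤c c≤s
    where
    s≤c : s ≤ c
    s≤c with compare s c
    ... | inj₁ s≤c = s≤c
    ... | inj₂ c<s with sums (s - c) (positive c<s)
    ...   | M , close = ⊥-elim (<-irrefl
      (proj₁ (close (M ℕ.+ N) (ℕ.m≤m+n M N)) ⊕< ≤-reflexive (eventually (M ℕ.+ N) (ℕ.m≤n+m N M)))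
        (solve 3 (λ a b c → a :- (a :- b) :+ c := c :+ b) refl _ _ _))
    c≤s : c ≤ s
    c≤s with compare c s
    ... | inj₁ c≤s = c≤s
    ... | inj₂ s<c with sums (c - s) (positive s<c)
    ...   | M , close = ⊥-elim (<-irrefl
      (proj₂ (close (M ℕ.+ N) (ℕ.m≤m+n M N)) ⊕< ≤-reflexive (sym (eventually (M ℕ.+ N) (ℕ.m≤n+m N M))))
        (solve 3 (λ a b c → a :+ b := c :+ (b :- c) :+ a) refl _ _ _))

  -- Unless `x` is `c`, some neighbourhood of `x` misses `c`. Phrased without negation, this covers
  -- both cases at once.
  separate : ∀ x c → ∃ λ ε → 0# < ε × (∀ {y} → Close ε x y → y ≈ c → x ≈ c)
  separate x c with em {P = x ≈ c}
  ... | yes x≈c = 1# , 0<1 , λ _ _ → x≈c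
  ... | no  x≉c with total x c
  ...   | inj₁ x≤c = c - x , positive (x≤c , x≉c) , λ (_ , y<) y≈c →
    ⊥-elim (<-irrefl (y< ⊕< ≤-reflexive (sym y≈c))
      (solve 3 (λ a b c → a :+ b := c :+ (b :- c) :+ a) refl _ _ _))
  ...   | inj₂ c≤x = x - c , positive (c≤x , x≉c ∘ sym) , λ (<y , _) y≈c →
    ⊥-elim (<-irrefl (<y ⊕< ≤-reflexive y≈c)
      (solve 3 (λ a b c → a :- (a :- b) :+ c := c :+ b) refl _ _ _))

  close-shrink : ∀ {ε ε′ x y} → ε ≤ ε′ → Close ε x y → Close ε′ x y
  close-shrink ε≤ε′ (l , r) = lin< (l ⊕< ε≤ε′)
    (solve 4 (λ a b c d → a :- (b :- c) := a :+ c :- (b :- d :+ d)) refl _ _ _ _) ,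
    lin< (r ⊕< ε≤ε′) (solve 4 (λ a b c d → a :+ b :- c := a :+ d :+ b :- (c :+ d)) refl _ _ _ _)

  close-cong : ∀ {ε x y y′} → y ≈ y′ → Close ε x y → Close ε x y′
  close-cong y≈y′ (l , r) = <-≤-trans l (≤-reflexive y≈y′) , ≤-<-trans (≤-reflexive (sym y≈y′)) r

  Open𝕀-∩ : ∀ {U V} → Open𝕀 U → Open𝕀 V → Open𝕀 (U ∩ V)
  Open𝕀-∩ U-open V-open x (x∈U , x∈V) =
    let ε , 0<ε , near  = U-open x x∈U
        δ , 0<δ , near′ = V-open x x∈V
        η , 0<η , η≤ε , η≤δ = smaller 0<ε 0<δ
    in η , 0<η , λ y close → near y (close-shrink η≤ε close) , near′ y (close-shrink η≤δ close)

  -- Borel sets are unions of `_∼_`-classes, whereas a set given by edge coordinates may contain one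
  -- copy of a vertex and not another; saturation repairs this.
  sat : Pred Point 0ℓ → Pred Point 0ℓ
  sat C q = ∃ λ p → p ∈ C × p ∼ q

  -- On a single edge, saturation adds at most the two ends, so closed sections remain closed. The
  -- neighbourhood of a point outside is kept clear of each end, unless the point is that end.
  sat-closed : ∀ {C} → (∀ e → Open𝕀 (λ x → (e , x) ∉ C)) → Open (∁ (sat C))
  sat-closed {C} open-sections =
    (λ {p} {q} p∼q p∉ (r , r∈C , r∼q) → p∉ (r , r∈C , ∼-trans {r} {q} {p} r∼q (∼-sym {p} {q} p∼q))) , section
    where
    section : ∀ e → Open𝕀 (λ x → (e , x) ∉ sat C)
    section e x ∉sat =
      let ε₀ , 0<ε₀ , sep₀  = separate (proj₁ x) 0#
          ε₁ , 0<ε₁ , sep₁  = separate (proj₁ x) 1#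
          ε₂ , 0<ε₂ , near  = open-sections e x (λ x∈C → ∉sat (_ , x∈C , ∼-refl {e , x}))
          δ , 0<δ , δ≤ε₀ , δ≤ε₁ = smaller 0<ε₀ 0<ε₁
          η , 0<η , η≤δ , η≤ε₂  = smaller 0<δ 0<ε₂
      in η , 0<η , λ
        { y close ((_ , y′) , p∈C , inj₁ (≡.refl , y′≈y)) →
            near y′ (close-cong (sym y′≈y) (close-shrink η≤ε₂ close)) p∈C
        ; y close (p , p∈C , inj₂ (v , p-v , inj₁ (y≈0 , s))) →
            ∉sat (p , p∈C , inj₂ (v , p-v , inj₁ (sep₀ (close-shrink (≤-trans η≤δ δ≤ε₀) close) y≈0 , s)))
        ; y close (p , p∈C , inj₂ (v , p-v , inj₂ (y≈1 , s))) →
            ∉sat (p , p∈C , inj₂ (v , p-v , inj₂ (sep₁ (close-shrink (≤-trans η≤δ δ≤ε₁) close) y≈1 , s)))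
        }

  sat-borel : ∀ {C} → (∀ e → Open𝕀 (λ x → (e , x) ∉ C)) → Borel (sat C)
  sat-borel open-sections = resp
    ((λ ¬∉ → decidable-stable em ¬∉) , λ ∈sat ∉sat → ∉sat ∈sat)
    (complement (open-set (sat-closed open-sections)))

  class : Point → BorelSet
  class q@(e₀ , x₀ , _) = sat C , sat-borel section
    where
    C : Pred Point 0ℓ
    C (e , x , _) = e ≡ e₀ × x ≈ x₀
    section : ∀ e → Open𝕀 (λ x → (e , x) ∉ C)
    section e x x∉C with em {P = e ≡ e₀}
    ... | no  e≢e₀   = 1# , 0<1 , λ _ _ (e≡e₀ , _) → e≢e₀ e≡e₀
    ... | yes ≡.refl =
      let ε , 0<ε , sep = separate (proj₁ x) x₀
      in ε , 0<ε , λ _ close (_ , y≈x₀) → x∉C (≡.refl , sep close y≈x₀)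

  ∈-class : ∀ {p q} → p ∼ q → p ∈ ⟦ class q ⟧
  ∈-class {p} {q} p∼q = q , (≡.refl , refl) , ∼-sym {p} {q} p∼q

  class-∼ : ∀ {p q} → p ∈ ⟦ class q ⟧ → p ∼ q
  class-∼ {p} {q} (r , r≈q , r∼p) = ∼-trans {p} {r} {q} (∼-sym {r} {p} r∼p) (inj₁ r≈q)

  module _ (v : Valuation) where
    open Valuation v

    μ-∪ : ∀ A B → ⟦ A ⟧ ⊥ ⟦ B ⟧ → μ (A ∪ᴮ B) ≈ μ A + μ B
    μ-∪ A B A⊥B = trans (μ-cong (A ∪ᴮ B) (⋃ᴮ (two A B)) (from , to))
      (sumsTo-unique 2 (additive (two A B) disjoint) partial)
      where
      to : ⟦ ⋃ᴮ (two A B) ⟧ ⊆ ⟦ A ⟧ ∪ ⟦ B ⟧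
      to (0 , p∈A) = inj₁ p∈A
      to (1 , p∈B) = inj₂ p∈B
      from : ⟦ A ⟧ ∪ ⟦ B ⟧ ⊆ ⟦ ⋃ᴮ (two A B) ⟧
      from (inj₁ p∈A) = 0 , p∈A
      from (inj₂ p∈B) = 1 , p∈B

      disjoint : ∀ i j → i ≢ j → ⟦ two A B i ⟧ ⊥ ⟦ two A B j ⟧
      disjoint 0 0 i≢j _ = i≢j ≡.refl
      disjoint 1 1 i≢j _ = i≢j ≡.refl
      disjoint 0 1 _ p∈ = A⊥B p∈
      disjoint 1 0 _ p∈ = A⊥B (swap p∈)

      tail : ∀ n → partialSum (μ ∘ two A B) (2 ℕ.+ n) ≈ μ A + μ B
      tail zero    = +-congʳ (+-identityˡ (μ A))
      tail (suc n) = trans (+-cong (tail n) (empty ∅ᴮ (λ _ ()))) (+-identityʳ _)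

      partial : ∀ n → 2 ℕ.≤ n → partialSum (μ ∘ two A B) n ≈ μ A + μ B
      partial (suc (suc n)) (s≤s (s≤s z≤n)) = tail n

    μ-∖ : ∀ A B → ⟦ A ⟧ ⊆ ⟦ B ⟧ → μ B ≈ μ A + μ (B ∖ᴮ A)
    μ-∖ A B A⊆B = trans (μ-cong B (A ∪ᴮ (B ∖ᴮ A)) (split , join)) (μ-∪ A (B ∖ᴮ A) λ (a , _ , ¬a) → ¬a a)
      where
      split : ⟦ B ⟧ ⊆ ⟦ A ∪ᴮ (B ∖ᴮ A) ⟧
      split {p} p∈B with em {P = p ∈ ⟦ A ⟧}
      ... | yes p∈A = inj₁ p∈A
      ... | no  p∉A = inj₂ (p∈B , p∉A)
      join : ⟦ A ∪ᴮ (B ∖ᴮ A) ⟧ ⊆ ⟦ B ⟧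
      join (inj₁ p∈A)       = A⊆B p∈A
      join (inj₂ (p∈B , _)) = p∈B

    μ-mono : ∀ A B → ⟦ A ⟧ ⊆ ⟦ B ⟧ → μ A ≤ μ B
    μ-mono A B A⊆B = lin (nonNeg (B ∖ᴮ A) ⊕ ≤-reflexive (sym (μ-∖ A B A⊆B)))
      (solve 3 (λ a b c → a :- b := c :+ a :- (:0 :+ (b :+ c))) refl _ _ _)

    μ-∁ : ∀ A → μ A + μ (∁ᴮ A) ≈ 1#
    μ-∁ A = trans (sym (μ-∪ A (∁ᴮ A) λ (a , ¬a) → ¬a a)) (whole (A ∪ᴮ ∁ᴮ A) all)
      where
      all : Universal ⟦ A ∪ᴮ ∁ᴮ A ⟧
      all p with em {P = p ∈ ⟦ A ⟧}
      ... | yes p∈A = inj₁ p∈A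
      ... | no  p∉A = inj₂ p∉A

    μ≤1 : ∀ A → μ A ≤ 1#
    μ≤1 A = lin (nonNeg (∁ᴮ A) ⊕ ≤-reflexive (μ-∁ A))
      (solve 2 (λ a b → :1 :- a := b :+ :1 :- (:0 :+ (a :+ b))) refl _ _)

    module _ (A : ℕ → BorelSet) (increasing : ∀ n → ⟦ A n ⟧ ⊆ ⟦ A (suc n) ⟧) where
      private
        D : ℕ → BorelSet
        D zero    = A zero
        D (suc n) = A (suc n) ∖ᴮ A n

        increasing′ : ∀ {m n} → m ℕ.≤′ n → ⟦ A m ⟧ ⊆ ⟦ A n ⟧
        increasing′ (ℕ.≤′-reflexive ≡.refl) = id
        increasing′ (ℕ.≤′-step m≤n)         = increasing _ ∘ increasing′ m≤n

        D⊆A : ∀ n → ⟦ D n ⟧ ⊆ ⟦ A n ⟧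
        D⊆A zero    = id
        D⊆A (suc n) = proj₁

        later : ∀ {i j} → i ℕ.< j → ⟦ D i ⟧ ⊥ ⟦ D j ⟧
        later {i} (s≤s i≤j) (p∈Di , _ , p∉Aj) = p∉Aj (increasing′ (ℕ.≤⇒≤′ i≤j) (D⊆A i p∈Di))

        disjoint : ∀ i j → i ≢ j → ⟦ D i ⟧ ⊥ ⟦ D j ⟧
        disjoint i j i≢j p∈ with ℕ.≤-total i j
        ... | inj₁ i≤j = later (ℕ.≤∧≢⇒< i≤j i≢j) p∈
        ... | inj₂ j≤i = later (ℕ.≤∧≢⇒< j≤i (i≢j ∘ ≡.sym)) (swap p∈)

        partial : ∀ n → partialSum (μ ∘ D) (suc n) ≈ μ (A n)
        partial zero    = +-identityˡ _
        partial (suc n) = trans (+-congʳ (partial n)) (sym (μ-∖ (A n) (A (suc n)) (increasing n)))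

        first : ∀ n → ⟦ A n ⟧ ⊆ ⟦ ⋃ᴮ D ⟧
        first zero    p∈A0 = 0 , p∈A0
        first (suc n) {p} p∈A with em {P = p ∈ ⟦ A n ⟧}
        ... | yes p∈An = first n p∈An
        ... | no  p∉An = suc n , p∈A , p∉An

      -- The layers `D` are disjoint and have the same union as `A`, and their sums telescope to
      -- `μ (A n)`.
      continuity-from-below : ∀ ε → 0# < ε → ∃ λ n → μ (⋃ᴮ A) - ε < μ (A n)
      continuity-from-below ε 0<ε with additive D disjoint ε 0<ε
      ... | N , close = N , approx-cong same (partial N) (proj₁ (close (suc N) (ℕ.n≤1+n N)))
        where
        same : μ (⋃ᴮ A) ≈ μ (⋃ᴮ D)
        same = μ-cong (⋃ᴮ A) (⋃ᴮ D) ((λ (n , p∈A) → first n p∈A) , λ (n , p∈D) → n , D⊆A n p∈D)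

    -- Borel sets are saturated, so a Borel subset of one class is empty or the entire class; a
    -- class of positive value would be an atom.
    class-null : ∀ A q → (∀ p → p ∈ ⟦ A ⟧ → p ∼ q) → μ A ≈ 0#
    class-null A q A⊆q with compare (μ A) 0#
    ... | inj₁ μA≤0 = antisym μA≤0 (nonNeg A)
    ... | inj₂ 0<μA = contradiction (0<μA , indivisible) (nonAtomic A)
      where
      indivisible : ∀ B → ⟦ B ⟧ ⊆ ⟦ A ⟧ → (μ B ≈ 0#) ⊎ (μ B ≈ μ A)
      indivisible B B⊆A with em {P = Satisfiable ⟦ B ⟧}
      ... | no  none      = inj₁ (empty B (λ p p∈B → none (p , p∈B)))
      ... | yes (p , p∈B) = inj₂ (μ-cong B A (B⊆A , λ {p′} p′∈A →
        borel-saturated (proj₂ B) (∼-trans {p} {q} {p′} (A⊆q p (B⊆A p∈B)) (∼-sym {p′} {q} (A⊆q p′ p′∈A))) p∈B))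

    covered-null : ∀ qs A → (∀ p → p ∈ ⟦ A ⟧ → Any (p ∼_) qs) → μ A ≈ 0#
    covered-null []       A covered = empty A λ p p∈A → uncovered {p} (covered p p∈A)
      where
      uncovered : ∀ {p} → ¬ Any (p ∼_) []
      uncovered ()
    covered-null (q ∷ qs) A covered = trans (μ-∖ A∩q A proj₁)
      (trans (+-cong (class-null A∩q q (λ p (_ , ¬¬p) → class-∼ {p} {q} (decidable-stable em (λ p∉ → ¬¬p p∉))))
                     (covered-null qs (A ∖ᴮ A∩q) rest))
             (+-identityˡ 0#))
      where
      A∩q : BorelSet
      A∩q = A ∖ᴮ (∁ᴮ (class q))
      rest : ∀ p → p ∈ ⟦ A ∖ᴮ A∩q ⟧ → Any (p ∼_) qs
      rest p (p∈A , p∉A∩q) with covered p p∈A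
      ... | here p∼q   = contradiction (p∈A , λ p∉q → p∉q (∈-class {p} {q} p∼q)) p∉A∩q
      ... | there p∼qs = p∼qs

    finite-null : ∀ A → FiniteSet ⟦ A ⟧ → μ A ≈ 0#
    finite-null A (qs , covered) = covered-null qs A covered

    almost-equal : ∀ A B → ⟦ A ⟧ ⊆ ⟦ B ⟧ → FiniteSet ⟦ B ∖ᴮ A ⟧ → μ A ≈ μ B
    almost-equal A B A⊆B finite = sym (trans (μ-∖ A B A⊆B)
      (trans (+-congˡ (finite-null (B ∖ᴮ A) finite)) (+-identityʳ (μ A))))

    cofinite : ∀ A → FiniteSet ⟦ ∁ᴮ A ⟧ → μ A ≈ 1#
    cofinite A finite = lin≈ (μ-∁ A ⊕≈ sym (finite-null (∁ᴮ A) finite))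
      (solve 2 (λ a b → :1 :- a := :1 :+ b :- (a :+ b :+ :0)) refl _ _)

-- Heights of points

module Heights (em : ∀ {ℓ} → ExcludedMiddle ℓ) (ℝ : CompleteOrderedField) (G : Graph)
               (rank : Fin (Graph.#E G) → ℕ) (reversed : Fin (Graph.#E G) → Bool) where
  open CompleteOrderedField ℝ hiding (zero)
  open OrderedField em ℝ
  open Solver ℝ using (solve; _:=_; _:+_; _:*_; _:-_; :-_; :0; :1)
  open ConsensusCut em ℝ
  open CakeMeasure em ℝ G
  open Graph G
  open Cake ℝ G

  ι : ℕ → Carrier
  ι zero    = 0#
  ι (suc n) = ι n + 1#

  0≤ι : ∀ n → 0# ≤ ι n
  0≤ι zero    = ≤-refl
  0≤ι (suc n) = lin (0≤ι n ⊕ 0≤1) (solve 1 (λ a → a :+ :1 :- :0 := a :+ :1 :- (:0 :+ :0)) refl _)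

  ι-mono : ∀ {m n} → m ℕ.≤ n → ι m ≤ ι n
  ι-mono {n = n} z≤n = 0≤ι n
  ι-mono (s≤s m≤n)   = ι-mono m≤n ⊕ ≤-refl

  along : Bool → Carrier → Carrier
  along false x = x
  along true  x = 1# - x

  -- This does not respect `_∼_`: the edge ends that meet at a vertex may have different heights.
  height : Point → Carrier
  height (e , x , _) = ι (rank e) + along (reversed e) x

  along-close : ∀ o {ε x y} → Close ε x y → Close ε (along o x) (along o y)
  along-close false close   = close
  along-close true  (l , r) = lin< r
    (solve 3 (λ a b c → :1 :- a :- (:1 :- b :- c) := b :+ c :- a) refl _ _ _) ,
    lin< l (solve 3 (λ a b c → :1 :- a :+ b :- (:1 :- c) := c :- (a :- b)) refl _ _ _)

  along-cong : ∀ o {x y} → x ≈ y → along o x ≈ along o y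
  along-cong false x≈y = x≈y
  along-cong true  x≈y = lin≈ (sym x≈y) (solve 2 (λ a b → :1 :- a :- (:1 :- b) := b :- a) refl _ _)

  along-injective : ∀ o {x y} → along o x ≈ along o y → x ≈ y
  along-injective false eq = eq
  along-injective true  eq = lin≈ (sym eq)
    (solve 2 (λ a b → a :- b := :1 :- b :- (:1 :- a)) refl _ _)

  0≤along : ∀ o ((x , _) : 𝕀) → 0# ≤ along o x
  0≤along false (_ , 0≤x , _) = 0≤x
  0≤along true  (_ , _ , x≤1) = lin x≤1 (solve 1 (λ a → :1 :- a :- :0 := :1 :- a) refl _)

  along≤1 : ∀ o ((x , _) : 𝕀) → along o x ≤ 1#
  along≤1 false (_ , _ , x≤1) = x≤1
  along≤1 true  (_ , 0≤x , _) = lin 0≤x (solve 1 (λ a → :1 :- (:1 :- a) := a :- :0) refl _)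

  along-involutive : ∀ o x → along o (along o x) ≈ x
  along-involutive false x = refl
  along-involutive true  x = solve 1 (λ a → :1 :- (:1 :- a) := a) refl _

  height-close : ∀ e {ε} {x y : 𝕀} → Close ε (proj₁ x) (proj₁ y) → Close ε (height (e , x)) (height (e , y))
  height-close e close with along-close (reversed e) close
  ... | l , r = lin< l
    (solve 4 (λ a b c d → a :+ b :- (a :+ c :- d) := b :- (c :- d)) refl _ _ _ _) ,
    lin< r (solve 4 (λ a b c d → a :+ b :+ c :- (a :+ d) := b :+ c :- d) refl _ _ _ _)

  height-cong : ∀ e {x y : 𝕀} → proj₁ x ≈ proj₁ y → height (e , x) ≈ height (e , y)
  height-cong e x≈y = +-congˡ (along-cong (reversed e) x≈y)

  height-injective : ∀ e {x y : 𝕀} → height (e , x) ≈ height (e , y) → proj₁ x ≈ proj₁ y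
  height-injective e eq = along-injective (reversed e) (lin≈ eq
    (solve 3 (λ a b c → a :- b := c :+ a :- (c :+ b)) refl _ _ _))

  along-between : ∀ o {x y z} → x ≤ y → y ≤ z →
    (along o x ≤ along o y × along o y ≤ along o z) ⊎ (along o z ≤ along o y × along o y ≤ along o x)
  along-between false x≤y y≤z = inj₁ (x≤y , y≤z)
  along-between true  x≤y y≤z = inj₂ (lin y≤z
    (solve 2 (λ a b → :1 :- a :- (:1 :- b) := b :- a) refl _ _) ,
    lin x≤y (solve 2 (λ a b → :1 :- a :- (:1 :- b) := b :- a) refl _ _))

  height-between : ∀ e {x y z : 𝕀} → proj₁ x ≤ proj₁ y → proj₁ y ≤ proj₁ z →
    let h = λ x → height (e , x) in (h x ≤ h y × h y ≤ h z) ⊎ (h z ≤ h y × h y ≤ h x)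
  height-between e x≤y y≤z = Sum.map (Product.map raise raise) (Product.map raise raise)
    (along-between (reversed e) x≤y y≤z)
    where
    raise : ∀ {x y} → x ≤ y → ι (rank e) + x ≤ ι (rank e) + y
    raise = +-monoʳ-≤ (ι (rank e))

  rank≤height : ∀ p → ι (rank (proj₁ p)) ≤ height p
  rank≤height (e , x) = lin (0≤along (reversed e) x)
    (solve 2 (λ a b → a :+ b :- a := b :- :0) refl _ _)

  height≤1+rank : ∀ p → height p ≤ ι (suc (rank (proj₁ p)))
  height≤1+rank (e , x) = lin (along≤1 (reversed e) x)
    (solve 2 (λ a b → a :+ :1 :- (a :+ b) := :1 :- b) refl _ _)

  at-height : ∀ e {s} → ι (rank e) ≤ s → s ≤ ι (suc (rank e)) → ∃ λ x → height (e , x) ≈ s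
  at-height e {s} lower upper =
    (along o (s - k) , 0≤along o y , along≤1 o y) , trans (+-congˡ (along-involutive o (s - k))) (cancel k s)
    where
    o : Bool
    o = reversed e
    k : Carrier
    k = ι (rank e)
    y : 𝕀
    y = s - k , lin lower
      (solve 2 (λ a b → a :- b :- :0 := a :- b) refl _ _) ,
      lin upper (solve 2 (λ a b → :1 :- (a :- b) := b :+ :1 :- a) refl _ _)
    cancel : ∀ k s → k + (s - k) ≈ s
    cancel k s = solve 2 (λ a b → a :+ (b :- a) := b) refl _ _

  -- Inside the edges `height` descends to the quotient, see `interior-∼`; what is left out are the
  -- finitely many edge ends, which are null.
  Interior : Pred Point 0ℓ
  Interior (_ , x , _) = 0# < x × x < 1#

  interior-not-vertex : ∀ {p v} → Interior p → ¬ AtVertex p v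
  interior-not-vertex (0<x , _) (inj₁ (x≈0 , _)) = <-irrefl 0<x (sym x≈0)
  interior-not-vertex (_ , x<1) (inj₂ (x≈1 , _)) = <-irrefl x<1 x≈1

  interior-∼ : ∀ {p q} → Interior q → p ∼ q → height p ≈ height q
  interior-∼ {e , x} {_ , y} q-int (inj₁ (≡.refl , x≈y)) = height-cong e {x} {y} x≈y
  interior-∼ {q = q} q-int (inj₂ (v , _ , q-v))  = contradiction q-v (interior-not-vertex {q} q-int)

  interior-open : ∀ e → Open𝕀 (λ x → Interior (e , x))
  interior-open e = Open𝕀-∩ {λ x → 0# < proj₁ x} {λ x → proj₁ x < 1#}
    (λ (x , _) 0<x → x , 0<x , λ _ (l , _) → lin< l
      (solve 2 (λ a b → a :- :0 := a :- (b :- b)) refl _ _))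
    (λ (x , _) x<1 → 1# - x , positive x<1 , λ _ (_ , r) → lin< r
      (solve 2 (λ a b → :1 :- a := b :+ (:1 :- b) :- a) refl _ _))

  -- Shared by `height` and its negative, so that one proof of left continuity yields right
  -- continuity as well.
  record IsSmooth (φ : Point → Carrier) : Set where
    field
      φ-cong  : ∀ e {x y : 𝕀} → proj₁ x ≈ proj₁ y → φ (e , x) ≈ φ (e , y)
      φ-close : ∀ e {ε} {x y : 𝕀} → Close ε (proj₁ x) (proj₁ y) → Close ε (φ (e , x)) (φ (e , y))

  height-smooth : IsSmooth height
  height-smooth = record
    { φ-cong = λ e {x} {y} → height-cong e {x} {y} ; φ-close = λ e {ε} {x} {y} → height-close e {ε} {x} {y} }

  depth-smooth : IsSmooth (λ p → - height p)
  depth-smooth = record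
    { φ-cong  = λ e {x} {y} x≈y → -‿cong (height-cong e {x} {y} x≈y)
    ; φ-close = λ e {ε} {x} {y} close →
        let l , r = height-close e {ε} {x} {y} close in lin< r
                (solve 4 (λ a b c d → :- (a :+ b) :- (:- (a :+ c) :- d) := a :+ c :+ d :- (a :+ b)) refl _ _ _ _) ,
                lin< l
                (solve 4 (λ a b c d → :- (a :+ b) :+ c :- (:- (a :+ d)) := a :+ d :- (a :+ b :- c)) refl _ _ _ _)
    }

  δ : ℕ → Carrier
  δ zero    = 1#
  δ (suc n) = δ n * ½

  0<δ : ∀ n → 0# < δ n
  0<δ zero    = 0<1
  0<δ (suc n) = ≰⇒> λ δ≤0 → <⇒≱ (0<δ n) (lin (δ≤0 ⊕ δ≤0 ⊕ ≤-reflexive (sym (halves (δ n))))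
    (solve 2 (λ a b → :0 :- a := :0 :+ :0 :+ (a :* b :+ a :* b) :- (a :* b :+ a :* b :+ a)) refl _ _))

  δ-decreasing : ∀ n → δ (suc n) ≤ δ n
  δ-decreasing n = lin (proj₁ (0<δ (suc n)) ⊕ ≤-reflexive (halves (δ n)))
    (solve 2 (λ a b → a :- a :* b := a :* b :+ a :- (:0 :+ (a :* b :+ a :* b))) refl _ _)

  -- The Archimedean property, from completeness. If `ε` were a lower bound of all powers of `½`,
  -- consider the supremum `σ` of such lower bounds: `σ + σ` is again one, whence `σ ≤ 0#`, against
  -- `ε ≤ σ`.
  δ-small : ∀ ε → 0# < ε → ∃ λ n → δ n < ε
  δ-small ε 0<ε with em {P = ∃ λ n → δ n < ε}
  ... | yes found = found
  ... | no  none  = ⊥-elim (impossible (complete S (ε , ε∈S) (1# , λ _ x≤δ → x≤δ 0)))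
    where
    S : Pred Carrier 0ℓ
    S x = ∀ n → x ≤ δ n

    ε∈S : S ε
    ε∈S n with compare ε (δ n)
    ... | inj₁ ε≤δ = ε≤δ
    ... | inj₂ δ<ε = contradiction (n , δ<ε) none

    impossible : ¬ ∃ (IsSupremum S)
    impossible (σ , upper , least) = <⇒≱ 0<ε (lin (upper ε ε∈S ⊕ upper (σ + σ) 2σ∈S)
      (solve 2 (λ a b → :0 :- a := b :+ b :- (a :+ (b :+ b))) refl _ _))
      where
      σ≤δ : ∀ n → σ ≤ δ n
      σ≤δ n = least (δ n) (λ _ x≤δ → x≤δ n)
      2σ∈S : S (σ + σ)
      2σ∈S n = ≤-trans (σ≤δ (suc n) ⊕ σ≤δ (suc n)) (≤-reflexive (halves (δ n)))

  module _ {φ : Point → Carrier} (smooth : IsSmooth φ) where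
    open IsSmooth smooth

    opaque
      below-open : ∀ s → Open (λ p → Interior p × φ p < s)
      below-open s = saturated , λ e → Open𝕀-∩ {λ x → Interior (e , x)} {λ x → φ (e , x) < s} (interior-open e)
        (λ x φx<s → s - φ (e , x) , positive φx<s , λ y close →
          lin< (proj₂ (φ-close e {x = x} {y} close))
            (solve 3 (λ a b c → a :- b := c :+ (a :- c) :- b) refl _ _ _))
        where
        saturated : ∀ {p q} → p ∼ q → Interior p × φ p < s → Interior q × φ q < s
        saturated {e , x} {_ , y} (inj₁ (≡.refl , x≈y)) ((0<x , x<1) , φp<s) =
          (<-≤-trans 0<x (≤-reflexive x≈y) , ≤-<-trans (≤-reflexive (sym x≈y)) x<1) ,
          ≤-<-trans (≤-reflexive (sym (φ-cong e {x} {y} x≈y))) φp<s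
        saturated {p} (inj₂ (v , p-v , _)) (p-int , _) = contradiction p-v (interior-not-vertex {p} p-int)

    below : Carrier → BorelSet
    below s = (λ p → Interior p × φ p < s) , open-set (below-open s)

    below-mono : ∀ {s s′} → s ≤ s′ → ⟦ below s ⟧ ⊆ ⟦ below s′ ⟧
    below-mono s≤s′ (int , φp<s) = int , <-≤-trans φp<s s≤s′

    module _ (v : Valuation) where
      open Valuation v

      -- The inequality in `below` is strict, so `below s` is the increasing union of the sets
      -- `below (s - δ n)`, and continuity from below applies.
      below-leftContinuous : LeftContinuous (μ ∘ below)
      below-leftContinuous s ε 0<ε =
        Product.map (λ n → s - δ n) (λ {n} close →
          lin< (0<δ n)
            (solve 2 (λ a b → a :- (a :- b) := b :- :0) refl _ _) ,
            approx-cong (μ-cong (below s) (⋃ᴮ A) (exhausts , bounded)) refl close)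
          (continuity-from-below v A increasing ε 0<ε)
        where
        A : ℕ → BorelSet
        A n = below (s - δ n)
        increasing : ∀ n → ⟦ A n ⟧ ⊆ ⟦ A (suc n) ⟧
        increasing n = below-mono (lin (δ-decreasing n)
                (solve 3 (λ a b c → a :- b :* c :- (a :- b) := b :- b :* c) refl _ _ _))
        exhausts : ⟦ below s ⟧ ⊆ ⟦ ⋃ᴮ A ⟧
        exhausts (int , φp<s) = Product.map₂ (λ δn<ε → int , lin< δn<ε
          (solve 3 (λ a b c → a :- b :- c := a :- c :- b) refl _ _ _)) (δ-small _ (positive φp<s))
        bounded : ⟦ ⋃ᴮ A ⟧ ⊆ ⟦ below s ⟧
        bounded (n , int , φp<) = int , lin< (φp< ⊕< proj₁ (0<δ n))
          (solve 3 (λ a b c → a :- b := a :- c :+ c :- (b :+ :0)) refl _ _ _)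

  points-at : Carrier → Fin #E → List Point
  points-at s e with em {P = ∃ λ x → height (e , x) ≈ s}
  ... | yes (x , _) = (e , x) ∷ []
  ... | no  _       = []

  ∈-points-at : ∀ {s} p → height p ≈ s → Any (p ∼_) (points-at s (proj₁ p))
  ∈-points-at {s} (e , x) hp≈s with em {P = ∃ λ x → height (e , x) ≈ s}
  ... | yes (y , hy≈s) = here (inj₁ (≡.refl , height-injective e {x} {y} (trans hp≈s (sym hy≈s))))
  ... | no  none       = contradiction (x , hp≈s) none

  ends : ∀ p → ¬ Interior p → p ∼ (proj₁ p , 0𝕀) ⊎ p ∼ (proj₁ p , 1𝕀)
  ends (e , x , 0≤x , x≤1) not-int with compare x 0# | compare 1# x
  ... | inj₁ x≤0 | _        = inj₁ (inj₁ (≡.refl , antisym x≤0 0≤x))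
  ... | inj₂ _   | inj₁ 1≤x = inj₂ (inj₁ (≡.refl , antisym x≤1 1≤x))
  ... | inj₂ 0<x | inj₂ x<1 = contradiction (0<x , x<1) not-int

  -- Each edge contributes its two ends and, `height` being injective along it, at most one point at
  -- height `a` and one at height `b`.
  finite-levels : ∀ {A} a b → (∀ p → p ∈ A → ¬ Interior p ⊎ height p ≈ a ⊎ height p ≈ b) → FiniteSet A
  finite-levels a b exceptional = List.concat (List.tabulate points) , λ p p∈A →
    Any.concat⁺ (Any.tabulate⁺ (proj₁ p) (listed p (exceptional p p∈A)))
    where
    points : Fin #E → List Point
    points e = (e , 0𝕀) ∷ (e , 1𝕀) ∷ points-at a e ++ points-at b e
    listed : ∀ p → ¬ Interior p ⊎ height p ≈ a ⊎ height p ≈ b → Any (p ∼_) (points (proj₁ p))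
    listed p (inj₁ not-int) with ends p not-int
    ... | inj₁ p∼0 = here p∼0
    ... | inj₂ p∼1 = there (here p∼1)
    listed p (inj₂ (inj₁ hp≈a)) = there (there (Any.++⁺ˡ (∈-points-at p hp≈a)))
    listed p (inj₂ (inj₂ hp≈b)) = there (there (Any.++⁺ʳ (points-at a (proj₁ p)) (∈-points-at p hp≈b)))

  -- Distribution functions of the height

  module _ (v : Valuation) where
    open Valuation v

    distribution codistribution : Carrier → Carrier
    distribution   = μ ∘ below height-smooth
    codistribution = μ ∘ below depth-smooth

    -- `codistribution (- s)` is the value of the interior points above height `s`, so the two sets
    -- leave out only vertices and points at height `s`.
    distribution-complement : ∀ s → distribution s + codistribution (- s) ≈ 1#
    distribution-complement s = trans (sym (μ-∪ v L R (λ {p} → disjoint {p}))) (cofinite v (L ∪ᴮ R) finite)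
      where
      L R : BorelSet
      L = below height-smooth s
      R = below depth-smooth (- s)
      disjoint : ⟦ L ⟧ ⊥ ⟦ R ⟧
      disjoint ((_ , h<s) , (_ , -h<-s)) = <-irrefl (h<s ⊕< proj₁ -h<-s)
        (solve 3 (λ a b c → a :+ b :- (a :+ b) := c :- c) refl _ _ _)
      finite : FiniteSet ⟦ ∁ᴮ (L ∪ᴮ R) ⟧
      finite = finite-levels s s λ p outside → exceptional p outside
        where
        exceptional : ∀ p → p ∉ ⟦ L ∪ᴮ R ⟧ → ¬ Interior p ⊎ height p ≈ s ⊎ height p ≈ s
        exceptional p outside with em {P = Interior p}
        ... | no not-int = inj₁ not-int
        ... | yes int with compare (height p) s | compare s (height p)
        ...   | inj₁ h≤s | inj₁ s≤h = inj₂ (inj₁ (antisym h≤s s≤h))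
        ...   | inj₂ s<h | _        = contradiction (inj₂ (int , lin< s<h
          (solve 3 (λ a b c → :- a :- (:- (b :+ c)) := b :+ c :- a) refl _ _ _))) outside
        ...   | _        | inj₂ h<s = contradiction (inj₁ (int , h<s)) outside

    -- Changing the sign of heights exchanges left and right: this is left continuity of
    -- `codistribution` at `- s`, read through `distribution-complement`.
    distribution-rightContinuous : RightContinuous distribution
    distribution-rightContinuous s ε 0<ε =
      reflect (below-leftContinuous depth-smooth v (- s) ε 0<ε)
      where
      neg-neg : ∀ x → - - x ≈ x
      neg-neg x = solve 1 (λ a → :- (:- a) := a) refl _

      unreflected : ∀ x → codistribution (- - x) ≈ codistribution x
      unreflected x = μ-cong (below depth-smooth (- - x)) (below depth-smooth x)
        ((λ {p} → below-mono depth-smooth {s′ = x} (≤-reflexive (neg-neg x)) {p}) ,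
         (λ {p} → below-mono depth-smooth {x} (≤-reflexive (sym (neg-neg x))) {p}))

      algebra : ∀ {F F′ G G′} → F + G ≈ 1# → F′ + G′ ≈ 1# → G - ε < G′ → F′ < F + ε
      algebra F+G≈1 F′+G′≈1 close = lin< (close ⊕< ≤-reflexive F′+G′≈1 ⊕< ≤-reflexive (sym F+G≈1))
        (solve 5 (λ a b c d e → a :+ b :- c := d :+ :1 :+ (a :+ e) :- (e :- b :+ (c :+ d) :+ :1)) refl _ _ _ _ _)

      reflect : (∃ λ s′ → s′ < - s × codistribution (- s) - ε < codistribution s′) →
                ∃ λ s′ → s < s′ × distribution s′ < distribution s + ε
      reflect (s′ , s′<-s , close) = - s′ , lin< s′<-s
        (solve 2 (λ a b → :- a :- b := :- b :- a) refl _ _) ,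
        algebra (distribution-complement s)
                (trans (+-congˡ (sym (unreflected s′))) (distribution-complement (- s′))) close

    distribution-isDistribution : IsDistribution distribution
    distribution-isDistribution = record
      { monotone    = λ {x} {y} x≤y → μ-mono v (below height-smooth x) (below height-smooth y) (λ {p} → below-mono height-smooth {x} {y} x≤y {p})
      ; continuousˡ = below-leftContinuous height-smooth v
      ; continuousʳ = distribution-rightContinuous
      ; 0≤F         = λ s → nonNeg (below height-smooth s)
      ; F≤1         = λ s → μ≤1 v (below height-smooth s)
      }

    distribution-0 : distribution 0# ≈ 0#
    distribution-0 = empty (below height-smooth 0#) λ p (_ , h<0) →
      <⇒≱ h<0 (≤-trans (0≤ι (rank (proj₁ p))) (rank≤height p))

    distribution-top : ∀ {n} → (∀ e → rank e ℕ.< n) → distribution (ι n) ≈ 1#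
    -- Only vertices are missing from `top`, so the two levels `0#` are fillers.
    distribution-top {n} rank<n = cofinite v top (finite-levels 0# 0# λ p p∉ → inj₁ (not-interior p p∉))
      where
      top : BorelSet
      top = below height-smooth (ι n)
      not-interior : ∀ p → p ∉ ⟦ top ⟧ → ¬ Interior p
      not-interior p@(e , x , _) p∉ int@(0<x , x<1) =
        p∉ (int , <-≤-trans (lin< along<1
          (solve 2 (λ a b → a :+ :1 :- (a :+ b) := :1 :- b) refl _ _)) (ι-mono (rank<n e)))
        where
        strict : ∀ o → along o x < 1#
        strict false = x<1
        strict true  = lin< 0<x (solve 1 (λ a → :1 :- (:1 :- a) := a :- :0) refl _)
        along<1 : along (reversed e) x < 1#
        along<1 = strict (reversed e)

-- Divisions by height

module Divisions (em : ∀ {ℓ} → ExcludedMiddle ℓ) (ℝ : CompleteOrderedField) (G : Graph)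
                 (rank : Fin (Graph.#E G) → ℕ) (reversed : Fin (Graph.#E G) → Bool) where
  open CompleteOrderedField ℝ hiding (zero)
  open OrderedField em ℝ
  open Solver ℝ using (solve; _:=_; _:+_; _:*_; _:-_; :-_; :0; :1)
  open ConsensusCut em ℝ
  open CakeMeasure em ℝ G
  open Heights em ℝ G rank reversed
  open Graph G
  open Cake ℝ G

  -- The cut heights belong to both sets, which makes both pieces closed and lets them overlap in
  -- finitely many points.
  Within Beyond : Carrier → Carrier → Pred Point 0ℓ
  Within a b p = a ≤ height p × height p ≤ b
  Beyond a b p = height p ≤ a ⊎ b ≤ height p

  opaque
    within-closed : ∀ a b e → Open𝕀 (λ x → (e , x) ∉ Within a b)
    within-closed a b e x x∉ with compare a (height (e , x)) | compare (height (e , x)) b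
    ... | inj₁ a≤h | inj₁ h≤b = contradiction (a≤h , h≤b) x∉
    ... | inj₂ h<a | _        = a - height (e , x) , positive h<a , λ y close (a≤h , _) →
      ⊥-elim (<-irrefl (proj₂ (height-close e {x = x} {y} close) ⊕< a≤h)
        (solve 4 (λ a b c d → a :+ b :+ c := a :+ d :+ (c :- (a :+ d)) :+ (a :+ b)) refl _ _ _ _))
    ... | _        | inj₂ b<h = height (e , x) - b , positive b<h , λ y close (_ , h≤b) →
      ⊥-elim (<-irrefl (proj₁ (height-close e {x = x} {y} close) ⊕< h≤b)
        (solve 4 (λ a b c d → a :+ b :- (a :+ b :- c) :+ (a :+ d) := a :+ d :+ c) refl _ _ _ _))

    beyond-closed : ∀ a b e → Open𝕀 (λ x → (e , x) ∉ Beyond a b)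
    beyond-closed a b e x x∉ with compare (height (e , x)) a | compare b (height (e , x))
    ... | inj₁ h≤a | _        = contradiction (inj₁ h≤a) x∉
    ... | _        | inj₁ b≤h = contradiction (inj₂ b≤h) x∉
    ... | inj₂ a<h | inj₂ h<b with smaller (positive a<h) (positive h<b)
    ...   | ε , 0<ε , ε≤h-a , ε≤b-h = ε , 0<ε , λ
      { y close (inj₁ h≤a) → ⊥-elim (<-irrefl (proj₁ (height-close e {x = x} {y} close) ⊕< h≤a ⊕< ε≤h-a)
              (solve 5 (λ a b c d e → a :+ b :- c :+ (a :+ d) :+ c := a :+ d :+ e :+ (a :+ b :- e)) refl _ _ _ _ _))
      ; y close (inj₂ b≤h) → ⊥-elim (<-irrefl (proj₂ (height-close e {x = x} {y} close) ⊕< b≤h ⊕< ε≤b-h)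
              (solve 5 (λ a b c d e → a :+ b :+ c :+ d := a :+ e :+ d :+ (a :+ b) :+ (c :- (a :+ e))) refl _ _ _ _ _))
      }

  between outside : Carrier → Carrier → BorelSet
  between a b = sat (Within a b) , sat-borel (within-closed a b)
  outside a b = sat (Beyond a b) , sat-borel (beyond-closed a b)

  Convex : Pred Carrier 0ℓ → Set
  Convex S = ∀ {x y z} → x ∈ S → z ∈ S → x ≤ y → y ≤ z → y ∈ S

  -- `height` is monotone along an edge, increasing or decreasing with its orientation, so a convex
  -- set of heights meets each edge in one subinterval.
  convex-piece : ∀ {S} → Convex S → IsPiece (sat (λ p → height p ∈ S))
  convex-piece {S} convex = List.tabulate intervals , λ p → mk⇔
    (λ ((e , x) , ∈S , ∼p) → Any.tabulate⁺ {P = p ∈ˢ_} {f = intervals} e (x , ∈S , ∼p))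
    (λ ∈Is → let e , x , ∈S , ∼p = Any.tabulate⁻ {P = p ∈ˢ_} {f = intervals} ∈Is in (e , x) , ∈S , ∼p)
    where
    intervals : Fin #E → Subinterval
    intervals e = e , (λ x → height (e , x) ∈ S) , λ {x} {y} {z} x∈S z∈S x≤y y≤z →
      Sum.[ (λ (hx≤hy , hy≤hz) → convex x∈S z∈S hx≤hy hy≤hz)
          , (λ (hz≤hy , hy≤hx) → convex z∈S x∈S hz≤hy hy≤hx)
          ]′ (height-between e {x} {y} {z} x≤y y≤z)

  between-piece : ∀ a b → IsPiece ⟦ between a b ⟧
  between-piece a b = convex-piece {λ s → a ≤ s × s ≤ b}
    λ (a≤x , _) (_ , z≤b) x≤y y≤z → ≤-trans a≤x x≤y , ≤-trans y≤z z≤b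

  outside-piece : ∀ a b → IsPiece ⟦ outside a b ⟧
  outside-piece a b =
    let Is , lower = convex-piece {_≤ a} λ _ z≤a _ y≤z → ≤-trans y≤z z≤a
        Js , upper = convex-piece {b ≤_} λ b≤x _ x≤y _ → ≤-trans b≤x x≤y
    in Is ++ Js , λ p → mk⇔
      (λ { (q , inj₁ h≤a , q∼p) → Any.++⁺ˡ (Equivalence.to (lower p) (q , h≤a , q∼p))
         ; (q , inj₂ b≤h , q∼p) → Any.++⁺ʳ Is (Equivalence.to (upper p) (q , b≤h , q∼p)) })
      (λ ∈ → Sum.[ (λ l → let q , h≤a , q∼p = Equivalence.from (lower p) l in q , inj₁ h≤a , q∼p)
                 , (λ u → let q , b≤h , q∼p = Equivalence.from (upper p) u in q , inj₂ b≤h , q∼p)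
                 ]′ (Any.++⁻ Is ∈))

  between-outside : ∀ a b → IsDivision ⟦ between a b ⟧ ⟦ outside a b ⟧
  between-outside a b = record
    { pieceˡ = between-piece a b
    ; pieceʳ = outside-piece a b
    ; covers = covers
    ; finite = finite-levels a b common
    }
    where
    covers : Universal (⟦ between a b ⟧ ∪ ⟦ outside a b ⟧)
    covers p with total (height p) a | total (height p) b
    ... | inj₁ h≤a | _        = inj₂ (p , inj₁ h≤a , ∼-refl {p})
    ... | inj₂ _   | inj₂ b≤h = inj₂ (p , inj₂ b≤h , ∼-refl {p})
    ... | inj₂ a≤h | inj₁ h≤b = inj₁ (p , (a≤h , h≤b) , ∼-refl {p})

    common : ∀ p → p ∈ ⟦ between a b ⟧ ∩ ⟦ outside a b ⟧ → ¬ Interior p ⊎ height p ≈ a ⊎ height p ≈ b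
    common p ((q , (a≤hq , hq≤b) , q∼p) , (r , r∈ , r∼p)) with em {P = Interior p}
    ... | no  not-int = inj₁ not-int
    ... | yes int = inj₂ (Sum.map
      (λ hr≤a → antisym (≤-trans (≤-reflexive (sym hr≈hp)) hr≤a) (≤-trans a≤hq (≤-reflexive hq≈hp)))
      (λ b≤hr → antisym (≤-trans (≤-reflexive (sym hq≈hp)) hq≤b) (≤-trans b≤hr (≤-reflexive hr≈hp))) r∈)
      where
      hq≈hp : height q ≈ height p
      hq≈hp = interior-∼ {q} {p} int q∼p
      hr≈hp : height r ≈ height p
      hr≈hp = interior-∼ {r} {p} int r∼p

  IsDivision-sym : ∀ {α β} → IsDivision α β → IsDivision β α
  IsDivision-sym division = record
    { pieceˡ = pieceʳ
    ; pieceʳ = pieceˡ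
    ; covers = Sum.swap ∘ covers
    ; finite = proj₁ finite , λ p → proj₂ finite p ∘ swap
    }
    where open IsDivision division

  module _ (v : Valuation) where
    open Valuation v

    -- The overlap of the two pieces is finite, hence null, so `α` has the same value as the
    -- complement of `β`.
    μ-complement : ∀ α β → IsDivision ⟦ α ⟧ ⟦ β ⟧ → μ β ≈ 1# - μ α
    μ-complement α β division = algebra sum same
      where
      open IsDivision division
      algebra : ∀ {x y z} → x + y ≈ 1# → z ≈ y → x ≈ 1# - z
      algebra x+y≈1 z≈y = lin≈ (x+y≈1 ⊕≈ z≈y)
        (solve 3 (λ a b c → :1 :- a :- b := :1 :+ c :- (b :+ c :+ a)) refl _ _ _)
      sum : μ β + μ (∁ᴮ β) ≈ 1#
      sum = μ-∁ v β
      ∁β⊆α : ⟦ ∁ᴮ β ⟧ ⊆ ⟦ α ⟧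
      ∁β⊆α {p} p∉β = Sum.fromInj₁ (λ p∈β → contradiction p∈β p∉β) (covers p)
      same : μ α ≈ μ (∁ᴮ β)
      same = sym (almost-equal v (∁ᴮ β) α ∁β⊆α
        (proj₁ finite , λ p (p∈α , ¬¬p∈β) → proj₂ finite p (p∈α , decidable-stable em ¬¬p∈β)))

    -- `B ∖ᴮ A` consists of the interior points with heights in [a , b); the piece adds only
    -- vertices and points at height `b`.
    μ-between : ∀ {a b} → a ≤ b → μ (between a b) ≈ distribution v b - distribution v a
    μ-between {a} {b} a≤b = algebra sum same
      where
      algebra : ∀ {x y z w} → x + y ≈ z → w ≈ y → w ≈ z - x
      algebra x+y≈z w≈y = lin≈ (x+y≈z ⊕≈ w≈y)
        (solve 4 (λ a b c d → a :- b :- c := a :+ d :- (b :+ d :+ c)) refl _ _ _ _)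
      A B : BorelSet
      A = below height-smooth a
      B = below height-smooth b
      A⊆B : ⟦ A ⟧ ⊆ ⟦ B ⟧
      A⊆B {p} = below-mono height-smooth a≤b {p}
      B∖A⊆between : ⟦ B ∖ᴮ A ⟧ ⊆ ⟦ between a b ⟧
      B∖A⊆between {p} ((int , h<b) , p∉A) with compare a (height p)
      ... | inj₁ a≤h = p , (a≤h , proj₁ h<b) , ∼-refl {p}
      ... | inj₂ h<a = contradiction (int , h<a) p∉A
      exceptional : ∀ p → p ∈ ⟦ between a b ∖ᴮ (B ∖ᴮ A) ⟧ → ¬ Interior p ⊎ height p ≈ b ⊎ height p ≈ b
      exceptional p ((q , (a≤hq , hq≤b) , q∼p) , p∉) with em {P = Interior p}
      ... | no  not-int = inj₁ not-int
      ... | yes int with interior-∼ {q} {p} int q∼p | compare b (height p)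
      ...   | hq≈hp | inj₁ b≤h = inj₂ (inj₁ (antisym (≤-trans (≤-reflexive (sym hq≈hp)) hq≤b) b≤h))
      ...   | hq≈hp | inj₂ h<b =
        contradiction ((int , h<b) , λ (_ , h<a) → <⇒≱ h<a (≤-trans a≤hq (≤-reflexive hq≈hp))) p∉
      sum : distribution v a + μ (B ∖ᴮ A) ≈ distribution v b
      sum = sym (μ-∖ v A B (λ {p} → A⊆B {p}))
      same : μ (between a b) ≈ μ (B ∖ᴮ A)
      same = sym (almost-equal v (B ∖ᴮ A) (between a b) (λ {p} → B∖A⊆between {p}) (finite-levels b b exceptional))

  between-division : ∀ {a b} → a ≤ b → ∀ v-A v-B {t} →
    Increments (distribution v-A) (distribution v-B) a b t →
    IsWeightedConsensusDivision v-A v-B t (between a b) (outside a b)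
  between-division {a} {b} a≤b v-A v-B {t} (ΔA , ΔB) = record
    { isDivision = between-outside a b
    ; A-left     = left v-A ΔA
    ; B-left     = left v-B ΔB
    ; A-right    = right v-A ΔA
    ; B-right    = right v-B ΔB
    }
    where
    open Valuation using (μ)
    left : ∀ v → distribution v b - distribution v a ≈ t → μ v (between a b) ≈ t
    left v Δ = trans (μ-between v a≤b) Δ
    right : ∀ v → distribution v b - distribution v a ≈ t → μ v (outside a b) ≈ 1# - t
    right v Δ = trans (μ-complement v (between a b) (outside a b) (between-outside a b)) (+-congˡ (-‿cong (left v Δ)))

  IsWeightedConsensusDivision-sym : ∀ {v-A v-B t} α β →
    IsWeightedConsensusDivision v-A v-B (1# - t) α β → IsWeightedConsensusDivision v-A v-B t β α
  IsWeightedConsensusDivision-sym {t = t} α β division = record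
    { isDivision = IsDivision-sym isDivision
    ; A-left     = trans A-right (cancel t)
    ; B-left     = trans B-right (cancel t)
    ; A-right    = A-left
    ; B-right    = B-left
    }
    where
    open IsWeightedConsensusDivision division
    cancel : ∀ t → 1# - (1# - t) ≈ t
    cancel t = solve 1 (λ a → :1 :- (:1 :- a) := a) refl _

  consensus-division : ∀ {n} → (∀ e → rank e ℕ.< n) → ∀ v-A v-B {t} → 0# ≤ t → t ≤ 1# →
    ∃₂ λ a b → IsWeightedConsensusDivision v-A v-B t (between a b) (outside a b)
             ⊎ IsWeightedConsensusDivision v-A v-B t (outside a b) (between a b)
  consensus-division {n} rank<n v-A v-B {t} 0≤t t≤1 = Product.map₂ (Product.map₂ λ {b} → divide)
    (consensus-cut (distribution-isDistribution v-A) (distribution-isDistribution v-B) (0≤ι n)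
      (distribution-0 v-A) (distribution-0 v-B) (distribution-top v-A rank<n) (distribution-top v-B rank<n) 0≤t t≤1)
    where
    divide : ∀ {a b} → a ≤ b × (Increments (distribution v-A) (distribution v-B) a b t
                              ⊎ Increments (distribution v-A) (distribution v-B) a b (1# - t)) →
             IsWeightedConsensusDivision v-A v-B t (between a b) (outside a b)
             ⊎ IsWeightedConsensusDivision v-A v-B t (outside a b) (between a b)
    divide (a≤b , inj₁ Δ) = inj₁ (between-division a≤b v-A v-B Δ)
    divide {a} {b} (a≤b , inj₂ Δ) = inj₂ (IsWeightedConsensusDivision-sym (between a b) (outside a b)
      (between-division a≤b v-A v-B Δ))

-- Breadth-first numbering of the edges

module Orientation (G : Graph) (reversed : Fin (Graph.#E G) → Bool) where
  open Graph G

  tail head : Fin #E → Fin #V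
  tail e = if reversed e then tgt e else src e
  head e = if reversed e then src e else tgt e

-- A rooted forest structure on the edges, together with a numbering in which the edges of
-- the subtree hanging below e have ranks between rank e and rank e + width (depth e).
record Layout (G : Graph) (r : ℕ) : Set where
  open Graph G
  field
    root     : Fin #V
    reversed : Fin #E → Bool
    rank     : Fin #E → ℕ
    depth    : Fin #E → Fin (suc r)
    width    : Fin (suc r) → ℕ
    bound    : ℕ

  open Orientation G reversed public

  field
    rank<bound : ∀ e → rank e ℕ.< bound
    1≤width    : ∀ k → 1 ℕ.≤ width k
    parent     : ∀ e → tail e ≡ root ⊎ ∃ λ f → head f ≡ tail e × rank f ℕ.< rank e
                                              × rank e ℕ.≤ rank f ℕ.+ width (depth f)
    apart      : ∀ e f → depth e ≡ depth f → e ≢ f →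
                 rank e ℕ.+ width (depth e) ℕ.≤ rank f ⊎ rank f ℕ.+ width (depth f) ℕ.≤ rank e

module Layouts (em : ∀ {ℓ} → ExcludedMiddle ℓ) (G : Graph) where
  open Graph G

  minimum : (P : Pred ℕ 0ℓ) → Satisfiable P → Satisfiable (IsMinimum P)
  minimum P (n , p) = <-rec (λ n → P n → Satisfiable (IsMinimum P)) search n p
    where
    search : ∀ n → (∀ {m} → m ℕ.< n → P m → Satisfiable (IsMinimum P)) → P n → Satisfiable (IsMinimum P)
    search n smaller p with em {P = ∃ λ m → m ℕ.< n × P m}
    ... | yes (m , m<n , q) = smaller m<n q
    ... | no  none          = n , p , λ m q → ℕ.≮⇒≥ λ m<n → none (m , m<n , q)

  module FromDistances {r : ℕ} (root : Fin #V) (dist : Fin #V → ℕ)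
                       (shortest : ∀ w → Walk G root w (dist w))
                       (dist≤ : ∀ {w k} → Walk G root w k → dist w ℕ.≤ k)
                       (dist≤r : ∀ w → dist w ℕ.≤ r) where

    forward : ∀ e → dist (tgt e) ℕ.≤ suc (dist (src e))
    forward e = dist≤ (fwd e (shortest (src e)))

    backward : ∀ e → dist (src e) ℕ.≤ suc (dist (tgt e))
    backward e = dist≤ (bwd e (shortest (tgt e)))

    -- Edges point away from the root: the tail is the nearer end, and `src` in case of a tie.
    reversed : Fin #E → Bool
    reversed e with dist (tgt e) ℕ.<? dist (src e)
    ... | yes _ = true
    ... | no  _ = false

    open Orientation G reversed

    level : Fin #E → ℕ
    level e = dist (tail e)

    level≤r : ∀ e → level e ℕ.≤ r
    level≤r e = dist≤r (tail e)

    -- The last edge of a shortest walk to `w` comes from distance `k`; as `w` is its farther end,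
    -- `w` is its head.
    entry : ∀ w k → dist w ≡ suc k → ∃ λ f → head f ≡ w × level f ≡ k
    entry w k eq = last (≡.subst (Walk G root w) eq (shortest w)) eq
      where
      last : ∀ {w} → Walk G root w (suc k) → dist w ≡ suc k → ∃ λ f → head f ≡ w × level f ≡ k
      last (fwd e walk) eq with dist (tgt e) ℕ.<? dist (src e) in found
      ... | yes t<s = contradiction (ℕ.<-≤-trans t<s (dist≤ walk))
              (ℕ.≤⇒≯ (ℕ.≤-trans (ℕ.n≤1+n k) (ℕ.≤-reflexive (≡.sym eq))))
      ... | no  _   = e , head≡ , ≡.trans (≡.cong dist tail≡) (ℕ.≤-antisym (dist≤ walk)
              (ℕ.s≤s⁻¹ (ℕ.≤-trans (ℕ.≤-reflexive (≡.sym eq)) (forward e))))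
        where
        head≡ : head e ≡ tgt e
        head≡ rewrite found = ≡.refl
        tail≡ : tail e ≡ src e
        tail≡ rewrite found = ≡.refl
      last (bwd e walk) eq with dist (tgt e) ℕ.<? dist (src e) in found
      ... | no  t≮s = contradiction (ℕ.≤-trans (s≤s (dist≤ walk)) (ℕ.≤-reflexive (≡.sym eq))) t≮s
      ... | yes _   = e , head≡ , ≡.trans (≡.cong dist tail≡) (ℕ.≤-antisym (dist≤ walk)
              (ℕ.s≤s⁻¹ (ℕ.≤-trans (ℕ.≤-reflexive (≡.sym eq)) (backward e))))
        where
        head≡ : head e ≡ src e
        head≡ rewrite found = ≡.refl
        tail≡ : tail e ≡ tgt e
        tail≡ rewrite found = ≡.refl

    -- The edges serve as the digits from 1 to `#E`. Zero is kept for the places beyond the depth of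
    -- an edge, and a nonzero last digit puts every edge after its parent.
    B : ℕ
    B = suc #E

    -- Place value of the digit at depth `k`, and at once the width of the block reserved for a
    -- subtree whose first edge has depth `k`.
    W : ℕ → ℕ
    W k = B ℕ.^ (r ℕ.∸ k)

    1≤W : ∀ k → 1 ℕ.≤ W k
    1≤W k = ℕ.m^n>0 B (r ℕ.∸ k)

    W-step : ∀ {k} → suc k ℕ.≤ r → W k ≡ B ℕ.* W (suc k)
    W-step {k} k<r = ≡.cong (B ℕ.^_) (ℕ.+-∸-assoc 1 k<r)

    -- An edge at level 0 has no parent and gets itself as a filler; `rank` ascends `level e` times
    -- and never asks for it. The level is a separate argument so that it can be matched on.
    up′ : ∀ e k → level e ≡ k → Fin #E
    up′ e zero    _  = e
    up′ e (suc k) eq = proj₁ (entry (tail e) k eq)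

    up : Fin #E → Fin #E
    up e = up′ e (level e) ≡.refl

    up-entry : ∀ e {k} → level e ≡ suc k → head (up e) ≡ tail e × level (up e) ≡ k
    up-entry e {k} eq = general (level e) ≡.refl eq
      where
      general : ∀ l (eq : level e ≡ l) → l ≡ suc k → head (up′ e l eq) ≡ tail e × level (up′ e l eq) ≡ k
      general (suc k) eq ≡.refl = proj₂ (entry (tail e) k eq)

    -- The edges on the way from the root to e are the digits of its rank, in base B.
    rankAt : ℕ → Fin #E → ℕ
    rankAt zero    e = suc (toℕ e) ℕ.* W 0
    rankAt (suc k) e = rankAt k (up e) ℕ.+ suc (toℕ e) ℕ.* W (suc k)

    next-digit : ∀ {e : Fin #E} w → suc (toℕ e) ℕ.* w ℕ.+ w ≡ suc (suc (toℕ e)) ℕ.* w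
    next-digit {e} w = ℕ.+-comm (suc (toℕ e) ℕ.* w) w

    digit-bound : ∀ (e : Fin #E) w → suc (toℕ e) ℕ.* w ℕ.+ w ℕ.≤ B ℕ.* w
    digit-bound e w = ℕ.≤-trans (ℕ.≤-reflexive (next-digit {e} w)) (ℕ.*-monoˡ-≤ w (s≤s (Fin.toℕ<n e)))

    digits-apart : ∀ {e f : Fin #E} w → e ≢ f →
      suc (toℕ e) ℕ.* w ℕ.+ w ℕ.≤ suc (toℕ f) ℕ.* w ⊎ suc (toℕ f) ℕ.* w ℕ.+ w ℕ.≤ suc (toℕ e) ℕ.* w
    digits-apart {e} {f} w e≢f with ℕ.≤-total (toℕ e) (toℕ f)
    ... | inj₁ e≤f = inj₁ (ℕ.≤-trans (ℕ.≤-reflexive (next-digit {e} w))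
                       (ℕ.*-monoˡ-≤ w (s≤s (ℕ.≤∧≢⇒< e≤f (λ eq → e≢f (Fin.toℕ-injective eq))))))
    ... | inj₂ f≤e = inj₂ (ℕ.≤-trans (ℕ.≤-reflexive (next-digit {f} w))
                       (ℕ.*-monoˡ-≤ w (s≤s (ℕ.≤∧≢⇒< f≤e (λ eq → e≢f (≡.sym (Fin.toℕ-injective eq)))))))

    -- A block of width `W k` has room for `B` blocks of width `W (suc k)`, and every digit in use
    -- is less than `B`.
    nested : ∀ k e → suc k ℕ.≤ r → rankAt (suc k) e ℕ.+ W (suc k) ℕ.≤ rankAt k (up e) ℕ.+ W k
    nested k e k<r = ℕ.≤-trans (ℕ.≤-reflexive (ℕ.+-assoc (rankAt k (up e)) _ _))
      (ℕ.+-monoʳ-≤ (rankAt k (up e)) (ℕ.≤-trans (digit-bound e (W (suc k))) (ℕ.≤-reflexive (≡.sym (W-step k<r)))))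

    rank-bound : ∀ k e → k ℕ.≤ r → rankAt k e ℕ.+ W k ℕ.≤ B ℕ.* W 0
    rank-bound zero    e _   = digit-bound e (W 0)
    rank-bound (suc k) e k<r = ℕ.≤-trans (nested k e k<r) (rank-bound k (up e) (ℕ.<⇒≤ k<r))

    -- Lexicographic comparison: edges with the same parent differ in the last digit; otherwise the
    -- blocks of the parents are disjoint by induction and contain those of `e` and `f`.
    apartAt : ∀ k e f → k ℕ.≤ r → e ≢ f →
              rankAt k e ℕ.+ W k ℕ.≤ rankAt k f ⊎ rankAt k f ℕ.+ W k ℕ.≤ rankAt k e
    apartAt zero    e f _   e≢f = digits-apart (W 0) e≢f
    apartAt (suc k) e f k<r e≢f with up e Fin.≟ up f
    ... | yes eq = Sum.map (shifted e f eq) (shifted f e (≡.sym eq)) (digits-apart (W (suc k)) e≢f)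
      where
      shifted : ∀ e f → up e ≡ up f → suc (toℕ e) ℕ.* W (suc k) ℕ.+ W (suc k) ℕ.≤ suc (toℕ f) ℕ.* W (suc k) →
                rankAt (suc k) e ℕ.+ W (suc k) ℕ.≤ rankAt (suc k) f
      shifted e f eq le = ℕ.≤-trans (ℕ.≤-reflexive (ℕ.+-assoc (rankAt k (up e)) _ _))
        (ℕ.+-mono-≤ (ℕ.≤-reflexive (≡.cong (rankAt k) eq)) le)
    ... | no  up≢ = Sum.map (separated e f) (separated f e) (apartAt k (up e) (up f) (ℕ.<⇒≤ k<r) up≢)
      where
      separated : ∀ e f → rankAt k (up e) ℕ.+ W k ℕ.≤ rankAt k (up f) →
                  rankAt (suc k) e ℕ.+ W (suc k) ℕ.≤ rankAt (suc k) f
      separated e f le = ℕ.≤-trans (nested k e k<r) (ℕ.≤-trans le (ℕ.m≤m+n _ _))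

    -- Depth `r` occurs for edges, loops included, both of whose ends are at distance `r` from the
    -- root; hence `r + 1` values.
    depth : Fin #E → Fin (suc r)
    depth e = Fin.fromℕ< (s≤s (level≤r e))

    toℕ-depth : ∀ e → toℕ (depth e) ≡ level e
    toℕ-depth e = Fin.toℕ-fromℕ< (s≤s (level≤r e))

    rank : Fin #E → ℕ
    rank e = rankAt (level e) e

    apart : ∀ e f → depth e ≡ depth f → e ≢ f →
            rank e ℕ.+ W (toℕ (depth e)) ℕ.≤ rank f ⊎ rank f ℕ.+ W (toℕ (depth f)) ℕ.≤ rank e
    apart e f same e≢f = general (level e) (level f) (toℕ (depth e)) (toℕ (depth f))
      (toℕ-depth e) (toℕ-depth f) (≡.cong toℕ same) (level≤r e)
      where
      general : ∀ k l m n → m ≡ k → n ≡ l → m ≡ n → k ℕ.≤ r →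
                rankAt k e ℕ.+ W m ℕ.≤ rankAt l f ⊎ rankAt l f ℕ.+ W n ℕ.≤ rankAt k e
      general k _ _ _ ≡.refl ≡.refl ≡.refl k≤r = apartAt k e f k≤r e≢f

    parent : ∀ e → tail e ≡ root ⊎ ∃ λ f → head f ≡ tail e × rankAt (level f) f ℕ.< rankAt (level e) e
             × rankAt (level e) e ℕ.≤ rankAt (level f) f ℕ.+ W (toℕ (depth f))
    parent e = by-level (level e) ≡.refl
      where
      nil-walk : ∀ {w} → Walk G root w 0 → w ≡ root
      nil-walk nil = ≡.refl

      by-level : ∀ l → level e ≡ l → tail e ≡ root ⊎ ∃ λ f → head f ≡ tail e × rankAt (level f) f ℕ.< rankAt l e
             × rankAt l e ℕ.≤ rankAt (level f) f ℕ.+ W (toℕ (depth f))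
      by-level zero    eq = inj₁ (nil-walk (≡.subst (Walk G root (tail e)) eq (shortest (tail e))))
      by-level (suc k) eq with up-entry e eq
      ... | head≡ , level≡ = inj₂ (up e , head≡ ,
        ≡.subst (λ l → rankAt l (up e) ℕ.< rankAt (suc k) e) (≡.sym level≡)
          (ℕ.m<m+n (rankAt k (up e)) (ℕ.≤-trans (1≤W (suc k)) (ℕ.m≤m+n (W (suc k)) _))) ,
        ≡.subst₂ (λ l l′ → rankAt (suc k) e ℕ.≤ rankAt l (up e) ℕ.+ W l′) (≡.sym level≡) (≡.sym (≡.trans (toℕ-depth (up e)) level≡))
          (ℕ.≤-trans (ℕ.m≤m+n _ _) (nested k e (ℕ.≤-trans (ℕ.≤-reflexive (≡.sym eq)) (level≤r e)))))

    layout : Layout G r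
    layout = record
      { root       = root
      ; reversed   = reversed
      ; rank       = rank
      ; depth      = depth
      ; width      = λ k → W (toℕ k)
      ; bound      = suc (B ℕ.* W 0)
      ; rank<bound = λ e → s≤s (ℕ.≤-trans (ℕ.m≤m+n _ _) (rank-bound (level e) e (level≤r e)))
      ; 1≤width    = λ k → 1≤W (toℕ k)
      ; parent     = parent
      ; apart      = apart
      }

  layout : Connected G → ∀ r → IsRadius G r → Layout G r
  layout (_ , walk) r ((root , _ , eccentric) , _) = FromDistances.layout root
    (λ w → proj₁ (shortest w))
    (λ w → proj₁ (proj₂ (shortest w)))
    (λ {w} {k} → proj₂ (proj₂ (shortest w)) k)
    (λ w → eccentric (proj₁ (shortest w)) (w , proj₂ (shortest w)))
    where
    shortest : ∀ w → Satisfiable (IsMinimum (Walk G root w))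
    shortest w = minimum (Walk G root w) (walk root w)

-- Paths

module Paths (em : ∀ {ℓ} → ExcludedMiddle ℓ) (ℝ : CompleteOrderedField) (G : Graph) where
  open CompleteOrderedField ℝ hiding (zero)
  open OrderedField em ℝ
  open Solver ℝ using (solve; _:=_; _:+_; _:*_; _:-_; :-_; :0; :1)
  open CakeMeasure em ℝ G
  open Graph G
  open Cake ℝ G

  ∼-setoid : Setoid 0ℓ 0ℓ
  ∼-setoid = record
    { Carrier       = Point
    ; _≈_           = _∼_
    ; isEquivalence = record
      { refl  = λ {p} → ∼-refl {p}
      ; sym   = λ {p} {q} → ∼-sym {p} {q}
      ; trans = λ {p} {q} {r} → ∼-trans {p} {q} {r}
      }
    }

  open SetoidReasoning ∼-setoid hiding (start)

  abstract
    1-0≈1 : 1# - 0# ≈ 1#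
    1-0≈1 = solve 0 (:1 :- :0 := :1) refl

    0≤1-x : ∀ {x} → x ≤ 1# → 0# ≤ 1# - x
    0≤1-x x≤1 = lin x≤1 (solve 1 (λ a → :1 :- a :- :0 := :1 :- a) refl _)

    1-x≤1 : ∀ {x} → 0# ≤ x → 1# - x ≤ 1#
    1-x≤1 0≤x = lin 0≤x (solve 1 (λ a → :1 :- (:1 :- a) := a :- :0) refl _)

    mirror-close : ∀ {ε x y} → Close ε x y → Close ε (1# - x) (1# - y)
    mirror-close (l , r) = lin< r
      (solve 3 (λ a b c → :1 :- a :- (:1 :- b :- c) := b :+ c :- a) refl _ _ _) ,
      lin< l (solve 3 (λ a b c → :1 :- a :+ b :- (:1 :- c) := c :- (a :- b)) refl _ _ _)

    0≤2x : ∀ {x} → 0# ≤ x → 0# ≤ x + x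
    0≤2x 0≤x = lin (0≤x ⊕ 0≤x) (solve 1 (λ a → a :+ a :- :0 := a :+ a :- (:0 :+ :0)) refl _)

    2x≤1 : ∀ {x} → x ≤ ½ → x + x ≤ 1#
    2x≤1 x≤½ = lin (x≤½ ⊕ x≤½ ⊕ ≤-reflexive ½+½≈1)
      (solve 2 (λ a b → :1 :- (a :+ a) := b :+ b :+ :1 :- (a :+ a :+ (b :+ b))) refl _ _)

    0≤2x-1 : ∀ {x} → ½ ≤ x → 0# ≤ x + x - 1#
    0≤2x-1 ½≤x = lin (½≤x ⊕ ½≤x ⊕ ≤-reflexive (sym ½+½≈1))
      (solve 2 (λ a b → a :+ a :- :1 :- :0 := a :+ a :+ (b :+ b) :- (b :+ b :+ :1)) refl _ _)

    2x-1≤1 : ∀ {x} → x ≤ 1# → x + x - 1# ≤ 1#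
    2x-1≤1 x≤1 = lin (x≤1 ⊕ x≤1)
      (solve 1 (λ a → :1 :- (a :+ a :- :1) := :1 :+ :1 :- (a :+ a)) refl _)

  module _ {α : Pred Point 0ℓ} where

    path-∼ : ∀ {p q} → p ∈ α → p ∼ q → Path α p q
    path-∼ {p} p∈α p∼q = record
      { γ          = λ _ → p
      ; γ-cong     = λ _ _ _ → ∼-refl {p}
      ; continuous = λ _ _ _ p∈U → 1# , 0<1 , λ _ _ → p∈U
      ; inside     = λ _ → p∈α
      ; start      = ∼-refl {p}
      ; end        = p∼q
      }

    path-sym : ∀ {p q} → Path α p q → Path α q p
    path-sym {p} {q} path = record
      { γ          = λ x → γ (mirror x)
      ; γ-cong     = λ x y x≈y → γ-cong (mirror x) (mirror y) (+-congˡ (-‿cong x≈y))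
      ; continuous = λ U U-open x x∈U →
          Product.map₂ (Product.map₂ λ near y close → near (mirror y) (mirror-close close))
            (continuous U U-open (mirror x) x∈U)
      ; inside     = λ x → inside (mirror x)
      ; start      = begin γ (mirror 0𝕀) ≈⟨ γ-cong (mirror 0𝕀) 1𝕀 1-0≈1 ⟩ γ 1𝕀 ≈⟨ end ⟩ q ∎
      ; end        = begin γ (mirror 1𝕀) ≈⟨ γ-cong (mirror 1𝕀) 0𝕀 (-‿inverseʳ 1#) ⟩ γ 0𝕀 ≈⟨ start ⟩ p ∎
      }
      where
      open Path path
      mirror : 𝕀 → 𝕀
      mirror (x , 0≤x , x≤1) = 1# - x , 0≤1-x x≤1 , 1-x≤1 0≤x

    path-∼ʳ : ∀ {p q q′} → Path α p q → q ∼ q′ → Path α p q′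
    path-∼ʳ {q = q} {q′} path q∼q′ = record
      { γ = γ ; γ-cong = γ-cong ; continuous = continuous ; inside = inside ; start = start
      ; end = ∼-trans {γ 1𝕀} {q} {q′} end q∼q′
      }
      where open Path path

    module _ {p q r : Point} (path₁ : Path α p q) (path₂ : Path α q r) where
      private
        module P₁ = Path path₁
        module P₂ = Path path₂

        first : (x : 𝕀) → proj₁ x ≤ ½ → 𝕀
        first (x , 0≤x , _) x≤½ = x + x , 0≤2x 0≤x , 2x≤1 x≤½

        second : (x : 𝕀) → ½ ≤ proj₁ x → 𝕀
        second (x , _ , x≤1) ½≤x = x + x - 1# , 0≤2x-1 ½≤x , 2x-1≤1 x≤1

        -- At `½` both halves apply and `total` may choose either one, so the two choices have to
        -- agree up to `_∼_`.
        junction : ∀ x x≤½ ½≤x → P₁.γ (first x x≤½) ∼ P₂.γ (second x ½≤x)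
        junction x@(x′ , _) x≤½ ½≤x = begin
          P₁.γ (first x x≤½)    ≈⟨ P₁.γ-cong (first x x≤½) 1𝕀 first≈1 ⟩
          P₁.γ 1𝕀               ≈⟨ P₁.end ⟩
          q                     ≈⟨ P₂.start ⟨
          P₂.γ 0𝕀               ≈⟨ P₂.γ-cong 0𝕀 (second x ½≤x) (sym second≈0) ⟩
          P₂.γ (second x ½≤x)   ∎
          where
          x≈½ : x′ ≈ ½
          x≈½ = antisym x≤½ ½≤x
          first≈1 : x′ + x′ ≈ 1#
          first≈1 = trans (x≈½ ⊕≈ x≈½) ½+½≈1
          second≈0 : x′ + x′ - 1# ≈ 0#
          second≈0 = lin≈ first≈1 (solve 1 (λ a → :0 :- (a :+ a :- :1) := :1 :- (a :+ a)) refl _)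

        Half : 𝕀 → Set
        Half x = proj₁ x ≤ ½ ⊎ ½ ≤ proj₁ x

        at : ∀ x → Half x → Point
        at x (inj₁ x≤½) = P₁.γ (first x x≤½)
        at x (inj₂ ½≤x) = P₂.γ (second x ½≤x)

        at-first : ∀ x (h : Half x) x≤½ → at x h ∼ P₁.γ (first x x≤½)
        at-first x (inj₁ x≤½′) x≤½ = P₁.γ-cong (first x x≤½′) (first x x≤½) refl
        at-first x (inj₂ ½≤x)  x≤½ = ∼-sym {P₁.γ (first x x≤½)} {P₂.γ (second x ½≤x)} (junction x x≤½ ½≤x)

        at-second : ∀ x (h : Half x) ½≤x → at x h ∼ P₂.γ (second x ½≤x)
        at-second x (inj₁ x≤½)  ½≤x = junction x x≤½ ½≤x
        at-second x (inj₂ ½≤x′) ½≤x = P₂.γ-cong (second x ½≤x′) (second x ½≤x) refl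

        half-of : ∀ x → Half x
        half-of x = total (proj₁ x) ½

        γ : 𝕀 → Point
        γ x = at x (half-of x)

        γ-first : ∀ x x≤½ → γ x ∼ P₁.γ (first x x≤½)
        γ-first x = at-first x (half-of x)

        γ-second : ∀ x ½≤x → γ x ∼ P₂.γ (second x ½≤x)
        γ-second x = at-second x (half-of x)

        γ-cong : ∀ x y → proj₁ x ≈ proj₁ y → γ x ∼ γ y
        γ-cong x y x≈y = Sum.[ by-first , by-second ]′ (total (proj₁ x) ½)
          where
          by-first : proj₁ x ≤ ½ → γ x ∼ γ y
          by-first x≤½ = begin
            γ x                   ≈⟨ γ-first x x≤½ ⟩
            P₁.γ (first x x≤½)    ≈⟨ P₁.γ-cong (first x x≤½) (first y y≤½) (x≈y ⊕≈ x≈y) ⟩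
            P₁.γ (first y y≤½)    ≈⟨ γ-first y y≤½ ⟨
            γ y                   ∎
            where
            y≤½ : proj₁ y ≤ ½
            y≤½ = ≤-trans (≤-reflexive (sym x≈y)) x≤½
          by-second : ½ ≤ proj₁ x → γ x ∼ γ y
          by-second ½≤x = begin
            γ x                   ≈⟨ γ-second x ½≤x ⟩
            P₂.γ (second x ½≤x)   ≈⟨ P₂.γ-cong (second x ½≤x) (second y ½≤y) (+-congʳ (x≈y ⊕≈ x≈y)) ⟩
            P₂.γ (second y ½≤y)   ≈⟨ γ-second y ½≤y ⟨
            γ y                   ∎
            where
            ½≤y : ½ ≤ proj₁ y
            ½≤y = ≤-trans ½≤x (≤-reflexive x≈y)

        at-inside : ∀ x (h : Half x) → at x h ∈ α
        at-inside x (inj₁ x≤½) = P₁.inside (first x x≤½)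
        at-inside x (inj₂ ½≤x) = P₂.inside (second x ½≤x)

        double-close : ∀ {η ε x y} → η + η ≈ ε → Close η x y → Close ε (x + x) (y + y)
        double-close η+η≈ε (l , r) =
          lin< (l ⊕< proj₁ l ⊕< ≤-reflexive η+η≈ε)
            (solve 4 (λ a b c d → a :+ a :- (b :+ b :- c) := a :+ a :+ c :- (b :- d :+ (b :- d) :+ (d :+ d))) refl _ _ _ _) ,
            lin< (r ⊕< proj₁ r ⊕< ≤-reflexive η+η≈ε)
            (solve 4 (λ a b c d → a :+ a :+ b :- (c :+ c) := a :+ d :+ (a :+ d) :+ b :- (c :+ c :+ (d :+ d))) refl _ _ _ _)

        translate-close : ∀ {ε x y} c → Close ε x y → Close ε (x - c) (y - c)
        translate-close c (l , r) = lin< l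
          (solve 4 (λ a b c d → a :- b :- (c :- b :- d) := a :- (c :- d)) refl _ _ _ _) ,
          lin< r (solve 4 (λ a b c d → a :- b :+ c :- (d :- b) := a :+ c :- d) refl _ _ _ _)

        module _ (U : Pred Point 0ℓ) (U-open : Open U) (x : 𝕀) (x∈U : γ x ∈ U) where

          NearFirst NearSecond : Set
          NearFirst  = ∃ λ ε → 0# < ε × (∀ y y≤½ → Close ε (proj₁ x) (proj₁ y) → P₁.γ (first y y≤½) ∈ U)
          NearSecond = ∃ λ ε → 0# < ε × (∀ y ½≤y → Close ε (proj₁ x) (proj₁ y) → P₂.γ (second y ½≤y) ∈ U)

          -- Continuity is checked on each half separately. If `x` lies beyond `½`, a neighbourhood
          -- that misses the first half satisfies the claim vacuously.
          near-first : NearFirst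
          near-first = Sum.[ left , right ]′ (compare (proj₁ x) ½)
            where
            left : proj₁ x ≤ ½ → NearFirst
            left x≤½ with P₁.continuous U U-open (first x x≤½) (proj₁ U-open {γ x} {P₁.γ (first x x≤½)} (γ-first x x≤½) x∈U)
            ... | ε , 0<ε , near with halve 0<ε
            ...   | η , 0<η , η+η≈ε = η , 0<η , λ y y≤½ close → near (first y y≤½) (double-close η+η≈ε close)
            right : ½ < proj₁ x → NearFirst
            right ½<x = proj₁ x - ½ , positive ½<x , λ y y≤½ (l , _) → ⊥-elim (<-irrefl (l ⊕< y≤½)
              (solve 3 (λ a b c → a :- (a :- b) :+ c := c :+ b) refl _ _ _))

          near-second : NearSecond
          near-second = Sum.[ right , left ]′ (compare ½ (proj₁ x))
            where
            right : ½ ≤ proj₁ x → NearSecond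
            right ½≤x with P₂.continuous U U-open (second x ½≤x) (proj₁ U-open {γ x} {P₂.γ (second x ½≤x)} (γ-second x ½≤x) x∈U)
            ... | ε , 0<ε , near with halve 0<ε
            ...   | η , 0<η , η+η≈ε = η , 0<η , λ y ½≤y close →
              near (second y ½≤y) (translate-close 1# (double-close η+η≈ε close))
            left : proj₁ x < ½ → NearSecond
            left x<½ = ½ - proj₁ x , positive x<½ , λ y ½≤y (_ , r) → ⊥-elim (<-irrefl (r ⊕< ½≤y)
              (solve 3 (λ a b c → a :+ b := c :+ (b :- c) :+ a) refl _ _ _))

          near-both : ∃ λ ε → 0# < ε × (∀ y → Close ε (proj₁ x) (proj₁ y) → γ y ∈ U)
          near-both = combine near-first near-second
            where
            combine : NearFirst → NearSecond → ∃ λ ε → 0# < ε × (∀ y → Close ε (proj₁ x) (proj₁ y) → γ y ∈ U)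
            combine (ε₁ , 0<ε₁ , near₁) (ε₂ , 0<ε₂ , near₂) with smaller 0<ε₁ 0<ε₂
            ... | ε , 0<ε , ε≤ε₁ , ε≤ε₂ = ε , 0<ε , λ y → near y (half-of y)
              where
              near : ∀ y (h : Half y) → Close ε (proj₁ x) (proj₁ y) → at y h ∈ U
              near y (inj₁ y≤½) close = near₁ y y≤½ (close-shrink ε≤ε₁ close)
              near y (inj₂ ½≤y) close = near₂ y ½≤y (close-shrink ε≤ε₂ close)

        0≤½ : 0# ≤ ½
        0≤½ with total 0# ½
        ... | inj₁ 0≤½ = 0≤½
        ... | inj₂ ½≤0 = ⊥-elim (<-irrefl (0<1 ⊕< ½≤0 ⊕< ½≤0 ⊕< ≤-reflexive (sym ½+½≈1))
          (solve 1 (λ a → :0 :+ a :+ a :+ :1 := :1 :+ :0 :+ :0 :+ (a :+ a)) refl _))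

        ½≤1 : ½ ≤ 1#
        ½≤1 = lin (0≤½ ⊕ ≤-reflexive ½+½≈1)
          (solve 1 (λ a → :1 :- a := a :+ :1 :- (:0 :+ (a :+ a))) refl _)

      path-trans : Path α p r
      path-trans = record
        { γ          = γ
        ; γ-cong     = γ-cong
        ; continuous = near-both
        ; inside     = λ x → at-inside x (half-of x)
        ; start      = begin
            γ 0𝕀                    ≈⟨ γ-first 0𝕀 0≤½ ⟩
            P₁.γ (first 0𝕀 0≤½)     ≈⟨ P₁.γ-cong (first 0𝕀 0≤½) 0𝕀 (+-identityˡ 0#) ⟩
            P₁.γ 0𝕀                 ≈⟨ P₁.start ⟩
            p                       ∎
        ; end        = begin
            γ 1𝕀                    ≈⟨ γ-second 1𝕀 ½≤1 ⟩
            P₂.γ (second 1𝕀 ½≤1)    ≈⟨ P₂.γ-cong (second 1𝕀 ½≤1) 1𝕀 1+1-1≈1 ⟩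
            P₂.γ 1𝕀                 ≈⟨ P₂.end ⟩
            r                       ∎
        }
        where
        1+1-1≈1 : 1# + 1# - 1# ≈ 1#
        1+1-1≈1 = solve 0 (:1 :+ :1 :- :1 := :1) refl

    -- The parametrisation is affine with speed `d`, which is at most 1, so it carries `ε`-close
    -- parameters to `ε`-close points of the edge.
    segment : ∀ e (x y : 𝕀) → proj₁ x ≤ proj₁ y →
              (∀ z → proj₁ x ≤ proj₁ z → proj₁ z ≤ proj₁ y → (e , z) ∈ α) → Path α (e , x) (e , y)
    segment e (x , 0≤x , x≤1) (y , 0≤y , y≤1) x≤y within = record
      { γ          = λ t → e , at t
      ; γ-cong     = λ s t s≈t → inj₁ (≡.refl , +-congˡ (*-congʳ s≈t))
      ; continuous = λ U U-open t t∈U →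
          Product.map₂ (Product.map₂ λ near s close → near (at s) (slow close)) (proj₂ U-open e (at t) t∈U)
      ; inside     = λ t → within (at t) (x≤at t) (at≤y t)
      ; start      = inj₁ (≡.refl , at-0)
      ; end        = inj₁ (≡.refl , at-1)
      }
      where
      d : Carrier
      d = y - x

      0≤d : 0# ≤ d
      0≤d = lin x≤y (solve 2 (λ a b → a :- b :- :0 := a :- b) refl _ _)

      d≤1 : d ≤ 1#
      d≤1 = lin (0≤x ⊕ y≤1) (algebra x y)
        where
        algebra : ∀ x y → 1# - (y - x) ≈ (x + 1#) - (0# + y)
        algebra x y = solve 2 (λ a b → :1 :- (a :- b) := b :+ :1 :- (:0 :+ a)) refl _ _

      x≤at : ((t , _) : 𝕀) → x ≤ x + t * d
      x≤at (t , 0≤t , _) = lin (*-nonNeg 0≤t 0≤d) (algebra x (t * d))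
        where
        algebra : ∀ x u → x + u - x ≈ u - 0#
        algebra x u = solve 2 (λ a b → a :+ b :- a := b :- :0) refl _ _

      at≤y : ((t , _) : 𝕀) → x + t * d ≤ y
      at≤y (t , _ , t≤1) = lin (*-nonNeg {1# - t} (lin t≤1
        (solve 1 (λ a → :1 :- a :- :0 := :1 :- a) refl _)) 0≤d) (algebra x y t)
        where
        algebra : ∀ x y t → y - (x + t * (y - x)) ≈ (1# - t) * (y - x) - 0#
        algebra x y t = solve 3 (λ a b c → a :- (b :+ c :* (a :- b)) := (:1 :- c) :* (a :- b) :- :0) refl _ _ _

      at : 𝕀 → 𝕀
      at t = x + proj₁ t * d , ≤-trans 0≤x (x≤at t) , ≤-trans (at≤y t) y≤1

      at-0 : x + 0# * d ≈ x
      at-0 = trans (+-congˡ (zeroˡ d)) (+-identityʳ x)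

      at-1 : x + 1# * d ≈ y
      at-1 = algebra x y
        where
        algebra : ∀ x y → x + 1# * (y - x) ≈ y
        algebra x y = solve 2 (λ a b → a :+ :1 :* (b :- a) := b) refl _ _

      grows : ∀ {s t} → s ≤ t → x + s * d ≤ x + t * d
      grows {s} {t} s≤t = lin (*-nonNeg {t - s} (lin s≤t
        (solve 2 (λ a b → a :- b :- :0 := a :- b) refl _ _)) 0≤d) (algebra x s t d)
        where
        algebra : ∀ x s t d → (x + t * d) - (x + s * d) ≈ (t - s) * d - 0#
        algebra x s t d = solve 4 (λ a b c d → a :+ b :* c :- (a :+ d :* c) := (b :- d) :* c :- :0) refl _ _ _ _

      growth : ∀ {s t} → s ≤ t → (x + t * d) - (x + s * d) ≤ t - s
      growth {s} {t} s≤t = lin (*-nonNeg {t - s} {1# - d} (lin s≤t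
        (solve 2 (λ a b → a :- b :- :0 := a :- b) refl _ _))
        (lin d≤1 (solve 1 (λ d → :1 :- d :- :0 := :1 :- d) refl d))) (algebra x s t d)
        where
        algebra : ∀ x s t d → (t - s) - ((x + t * d) - (x + s * d)) ≈ (t - s) * (1# - d) - 0#
        algebra x s t d = solve 4 (λ a b c d → a :- b :- (c :+ a :* d :- (c :+ b :* d)) := (a :- b) :* (:1 :- d) :- :0) refl _ _ _ _

      slow : ∀ {ε s t} → Close ε t s → Close ε (x + t * d) (x + s * d)
      slow {ε} {s} {t} close = combine (total s t)
        where
        rising : ∀ {ε s t u w} → t ≤ s → w - u ≤ s - t → u ≤ w → Close ε t s → Close ε u w
        rising t≤s w-u≤s-t u≤w (l , r) =
          lin< (r ⊕< u≤w ⊕< u≤w ⊕< w-u≤s-t)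
            (solve 5 (λ a b c d e → a :- (b :- c) := d :+ c :+ a :+ a :+ (e :- d) :- (e :+ b :+ b :+ (a :- b))) refl _ _ _ _ _) ,
            lin< (r ⊕< w-u≤s-t)
            (solve 5 (λ a b c d e → a :+ b :- c := d :+ b :+ (e :- d) :- (e :+ (c :- a))) refl _ _ _ _ _)
        combine : s ≤ t ⊎ t ≤ s → Close ε (x + t * d) (x + s * d)
        combine (inj₂ t≤s) = rising t≤s (growth t≤s) (grows t≤s) close
        combine (inj₁ s≤t) = flipped (proj₁ close) (growth s≤t) (grows s≤t)
          where
          flipped : ∀ {u w} → t - ε < s → u - w ≤ t - s → w ≤ u → Close ε u w
          flipped l u-w≤t-s w≤u = lin< (l ⊕< u-w≤t-s)
            (solve 5 (λ a b c d e → a :- (b :- c) := d :+ (e :- d) :- (e :- c :+ (b :- a))) refl _ _ _ _ _) ,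
            lin< (l ⊕< w≤u ⊕< w≤u ⊕< u-w≤t-s)
            (solve 5 (λ a b c d e → a :+ b :- c := d :+ a :+ a :+ (e :- d) :- (e :- b :+ c :+ c :+ (a :- c))) refl _ _ _ _ _)

  -- Counting path components

  search : ∀ {a k} (P : Fin k → Set a) → ∃ P → ∃ P
  search {k = suc k} P (i , p) with em {P = P Fin.zero}
  ... | yes p₀ = Fin.zero , p₀
  ... | no ¬p₀ = Product.map Fin.suc id (search (P ∘ Fin.suc) (later i p))
    where
    later : ∀ i → P i → ∃ (P ∘ Fin.suc)
    later Fin.zero    p = contradiction p ¬p₀
    later (Fin.suc i) p = i , p

  -- `search` returns the least index, which depends on the extent of the predicate and not on the
  -- witness supplied.
  search-cong : ∀ {a b k} (P : Fin k → Set a) (Q : Fin k → Set b) (p : ∃ P) (q : ∃ Q) →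
                (∀ {i} → P i → Q i) → (∀ {i} → Q i → P i) → proj₁ (search P p) ≡ proj₁ (search Q q)
  search-cong {k = suc k} P Q p q to from with em {P = P Fin.zero} | em {P = Q Fin.zero}
  ... | yes _  | yes _  = ≡.refl
  ... | yes p₀ | no ¬q₀ = contradiction (to p₀) ¬q₀
  ... | no ¬p₀ | yes q₀ = contradiction (from q₀) ¬p₀
  ... | no _   | no _   = ≡.cong Fin.suc (search-cong (P ∘ Fin.suc) (Q ∘ Fin.suc) _ _ to from)

  -- The component of a point is named after the least label that occurs in it.
  components : ∀ {α k} (label : ∀ p → p ∈ α → Fin k) →
    (∀ {p q} (p∈α : p ∈ α) (q∈α : q ∈ α) → label p p∈α ≡ label q q∈α → Path α p q) →
    AtMostComponents k α
  components {α} label connected = (λ p p∈α → proj₁ (least p p∈α)) , λ p q p∈α q∈α → mk⇔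
    (λ eq → same (proj₂ (least p p∈α)) (≡.subst (Occurs q) (≡.sym eq) (proj₂ (least q q∈α))))
    (λ path → search-cong (Occurs p) (Occurs q) (own p p∈α) (own q q∈α)
      (transport (path-sym path)) (transport path))
    where
    Occurs : Point → Fin _ → Set₁
    Occurs p i = ∃ λ q → ∃ λ (q∈α : q ∈ α) → label q q∈α ≡ i × Path α p q

    own : ∀ p p∈α → ∃ (Occurs p)
    own p p∈α = label p p∈α , p , p∈α , ≡.refl , path-∼ p∈α (∼-refl {p})

    least : ∀ p p∈α → ∃ (Occurs p)
    least p p∈α = search (Occurs p) (own p p∈α)

    transport : ∀ {p q} → Path α p q → ∀ {i} → Occurs q i → Occurs p i
    transport path (r , r∈α , label≡ , path′) = r , r∈α , label≡ , path-trans path path′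

    same : ∀ {p q i} → Occurs p i → Occurs q i → Path α p q
    same (p′ , p′∈α , ≡i , path) (q′ , q′∈α , ≡i′ , path′) =
      path-trans path (path-trans (connected p′∈α q′∈α (≡.trans ≡i (≡.sym ≡i′))) (path-sym path′))

-- Components of the pieces

module Components (em : ∀ {ℓ} → ExcludedMiddle ℓ) (ℝ : CompleteOrderedField) (G : Graph)
                  {r : ℕ} (L : Layout G r) where
  open Layout L
  open CompleteOrderedField ℝ hiding (zero)
  open OrderedField em ℝ
  open Solver ℝ using (solve; _:=_; _:+_; _:*_; _:-_; :-_; :0; :1)
  open CakeMeasure em ℝ G
  open Heights em ℝ G rank reversed
  open Divisions em ℝ G rank reversed
  open Paths em ℝ G
  open Graph G
  open Cake ℝ G

  tail-point : ∀ e → ∃ λ x → height (e , x) ≈ ι (rank e) × AtVertex (e , x) (tail e)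
  tail-point e with reversed e
  ... | false = 0𝕀 , +-identityʳ _ , inj₁ (refl , ≡.refl)
  ... | true  = 1𝕀 , trans (+-congˡ (-‿inverseʳ 1#)) (+-identityʳ _) , inj₂ (refl , ≡.refl)

  head-point : ∀ e → ∃ λ x → height (e , x) ≈ ι (suc (rank e)) × AtVertex (e , x) (head e)
  head-point e with reversed e
  ... | false = 1𝕀 , refl , inj₂ (refl , ≡.refl)
  ... | true  = 0𝕀 , +-congˡ 1-0≈1 , inj₁ (refl , ≡.refl)

  -- Walking down from a point of height at least a, one either reaches the root or stops at an
  -- edge f whose block of ranks contains a. It stops at the cut, if that lies on f, and at the
  -- head of f otherwise.
  StopsAt : Carrier → Fin #E → Pred Point 0ℓ
  StopsAt a f q = (a ≤ ι (suc (rank f)) × proj₁ q ≡ f × height q ≈ a)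
                ⊎ (ι (suc (rank f)) < a × AtVertex q (head f))

  -- The position of `a` relative to the head of `f` decides the case for both points; along `f`
  -- each height is attained at most once, and the head is a single vertex.
  stop-unique : ∀ {a f p q} → StopsAt a f p → StopsAt a f q → p ∼ q
  stop-unique {p = e , x} {_ , y} (inj₁ (_ , ≡.refl , hp≈a)) (inj₁ (_ , ≡.refl , hq≈a)) =
    inj₁ (≡.refl , height-injective e {x} {y} (trans hp≈a (sym hq≈a)))
  stop-unique (inj₁ (a≤ , _)) (inj₂ (<a , _))     = contradiction a≤ (<⇒≱ <a)
  stop-unique (inj₂ (<a , _)) (inj₁ (a≤ , _))     = contradiction a≤ (<⇒≱ <a)
  stop-unique (inj₂ (_ , p-v)) (inj₂ (_ , q-v))   = inj₂ (_ , p-v , q-v)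

  -- How the walk from `p` ends. The bounds in `stops` place `a` in the block of `f`; they are
  -- strict on one side only, so that adjacent blocks do not share `a`.
  data Reach (α : Pred Point 0ℓ) (a : Carrier) (p : Point) : Set₁ where
    at-root : ∀ {q} → AtVertex q root → Path α p q → Reach α a p
    stops   : ∀ {q} f → ι (rank f) < a → a ≤ ι (rank f ℕ.+ width (depth f)) →
              StopsAt a f q → Path α p q → Reach α a p

  reach-via : ∀ {α a p q} → Path α p q → Reach α a q → Reach α a p
  reach-via path (at-root q-root path′)   = at-root q-root (path-trans path path′)
  reach-via path (stops f f<a a≤ at path′) = stops f f<a a≤ at (path-trans path path′)

  label : ∀ {α a p} → Reach α a p → Fin (2 ℕ.+ r)
  label (at-root _ _)     = Fin.zero
  label (stops f _ _ _ _) = Fin.suc (depth f)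

  blocks-disjoint : ∀ {a e f} → ι (rank e) < a → a ≤ ι (rank e ℕ.+ width (depth e)) →
                    ι (rank f) < a → a ≤ ι (rank f ℕ.+ width (depth f)) → depth e ≡ depth f → e ≡ f
  blocks-disjoint {a} {e} {f} e<a a≤e f<a a≤f same with e Fin.≟ f
  ... | yes e≡f = e≡f
  ... | no  e≢f with apart e f same e≢f
  ...   | inj₁ e-first = contradiction (≤-trans a≤e (ι-mono e-first)) (<⇒≱ f<a)
  ...   | inj₂ f-first = contradiction (≤-trans a≤f (ι-mono f-first)) (<⇒≱ e<a)

  same-label : ∀ {α a p q} → (x : Reach α a p) (y : Reach α a q) → label x ≡ label y → Path α p q
  same-label {α} (at-root {p′} p′-root path) (at-root {q′} q′-root path′) _ =
    path-trans path (path-sym (path-∼ʳ path′ (inj₂ (root , q′-root , p′-root))))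
  same-label (stops {p′} e e<a a≤e at path) (stops {q′} f f<a a≤f at′ path′) same
    with blocks-disjoint e<a a≤e f<a a≤f (Fin.suc-injective same)
  ... | ≡.refl = path-trans path (path-sym (path-∼ʳ path′ (stop-unique {p = q′} {p′} at′ at)))

  module _ {α : Pred Point 0ℓ} {a b : Carrier} (within⊆α : Within a b ⊆ α) where

    edge-path : ∀ {e} {x y : 𝕀} → (e , x) ∈ Within a b → (e , y) ∈ Within a b → Path α (e , x) (e , y)
    edge-path {e} {x} {y} p∈ q∈ = Sum.[ (λ x≤y → forwards {x} {y} x≤y p∈ q∈)
                                      , (λ y≤x → path-sym (forwards {y} {x} y≤x q∈ p∈)) ]′ (total (proj₁ x) (proj₁ y))
      where
      forwards : ∀ {x y : 𝕀} → proj₁ x ≤ proj₁ y →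
                 (e , x) ∈ Within a b → (e , y) ∈ Within a b → Path α (e , x) (e , y)
      forwards {x} {y} x≤y (a≤hx , hx≤b) (a≤hy , hy≤b) = segment e x y x≤y λ z x≤z z≤y → within⊆α {e , z}
        (Sum.[ (λ (hx≤hz , hz≤hy) → ≤-trans a≤hx hx≤hz , ≤-trans hz≤hy hy≤b)
             , (λ (hy≤hz , hz≤hx) → ≤-trans a≤hy hy≤hz , ≤-trans hz≤hx hx≤b)
             ]′ (height-between e {x} {z} {y} x≤z z≤y))

    -- Induction on the rank of the current edge, as a parent has smaller rank. Height never
    -- increases on the way, so the walk stays below `b` and only `a` can stop it.
    climb : ∀ p → p ∈ Within a b → Reach α a p
    climb p = <-rec (λ n → ∀ p → rank (proj₁ p) ≡ n → p ∈ Within a b → Reach α a p) step _ p ≡.refl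
      where
      step : ∀ n → (∀ {m} → m ℕ.< n → ∀ p → rank (proj₁ p) ≡ m → p ∈ Within a b → Reach α a p) →
             ∀ p → rank (proj₁ p) ≡ n → p ∈ Within a b → Reach α a p
      step _ lower p@(e , x) ≡.refl p∈@(a≤h , h≤b) = Sum.[ onwards , stop ]′ (compare a (ι (rank e)))
        where
        stop : ι (rank e) < a → Reach α a p
        stop e<a = finish (at-height e (proj₁ e<a) a≤head)
          where
          a≤head : a ≤ ι (suc (rank e))
          a≤head = ≤-trans a≤h (height≤1+rank p)
          finish : (∃ λ y → height (e , y) ≈ a) → Reach α a p
          -- Here `a` lies on `e` itself, which takes up the first unit of its own block.
          finish (y , hy≈a) = stops {q = e , y} e e<a
            (≤-trans a≤head (ι-mono (ℕ.≤-trans (ℕ.≤-reflexive (ℕ.+-comm 1 (rank e)))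
              (ℕ.+-monoʳ-≤ (rank e) (1≤width (depth e))))))
            (inj₁ (a≤head , ≡.refl , hy≈a))
            (edge-path {e} {x} {y} p∈
              (≤-reflexive (sym hy≈a) , ≤-trans (≤-reflexive hy≈a) (≤-trans a≤h h≤b)))

        onwards : a ≤ ι (rank e) → Reach α a p
        onwards a≤e = via (tail-point e)
          where
          e≤b : ι (rank e) ≤ b
          e≤b = ≤-trans (rank≤height p) h≤b
          via : (∃ λ y → height (e , y) ≈ ι (rank e) × AtVertex (e , y) (tail e)) → Reach α a p
          via (y , hy≈ , tail-y) = reach-via to-tail (continue (parent e))
            where
            q∈ : (e , y) ∈ Within a b
            q∈ = ≤-trans a≤e (≤-reflexive (sym hy≈)) , ≤-trans (≤-reflexive hy≈) e≤b
            to-tail : Path α p (e , y)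
            to-tail = edge-path {e} {x} {y} p∈ q∈
            rest : Path α (e , y) (e , y)
            rest = path-∼ (within⊆α {e , y} q∈) (∼-refl {e , y})
            continue : (tail e ≡ root ⊎ ∃ λ f → head f ≡ tail e × rank f ℕ.< rank e
                          × rank e ℕ.≤ rank f ℕ.+ width (depth f)) → Reach α a (e , y)
            continue (inj₁ ≡root) = at-root {q = e , y} (≡.subst (AtVertex (e , y)) ≡root tail-y) rest
            continue (inj₂ (f , head≡ , f<e , e≤)) = Sum.[ below-parent (head-point f) , at-parent ]′ (compare a (ι (suc (rank f))))
              where
              at-parent : ι (suc (rank f)) < a → Reach α a (e , y)
              -- Here `a` falls between the head of `f` and the tail of `e`, so the walk ends at
              -- their common vertex. As `a` is at most `rank e`, which is within the block of `f`,
              -- so is `a`.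
              at-parent f<a = stops {q = e , y} f (≤-<-trans (ι-mono (ℕ.n≤1+n (rank f))) f<a)
                (≤-trans a≤e (ι-mono e≤)) (inj₂ (f<a , ≡.subst (AtVertex (e , y)) (≡.sym head≡) tail-y)) rest
              below-parent : (∃ λ z → height (f , z) ≈ ι (suc (rank f)) × AtVertex (f , z) (head f)) →
                             a ≤ ι (suc (rank f)) → Reach α a (e , y)
              below-parent (z , hz≈ , head-z) a≤f =
                -- The walk passes to `f` at the common vertex; its height there is at most that at
                -- the tail of `e`, because `rank f` is less than `rank e`.
                reach-via (path-∼ʳ rest (inj₂ (tail e , tail-y , ≡.subst (AtVertex (f , z)) head≡ head-z)))
                  (lower f<e (f , z) ≡.refl
                    (≤-trans a≤f (≤-reflexive (sym hz≈)) , ≤-trans (≤-reflexive hz≈) (≤-trans (ι-mono f<e) e≤b)))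

  reach-components : ∀ {α a} → (∀ p → p ∈ α → Reach α a p) → AtMostComponents (2 ℕ.+ r) α
  reach-components reach = components (λ p p∈α → label (reach p p∈α))
    (λ {p} {q} p∈α q∈α → same-label (reach p p∈α) (reach q q∈α))

  between-components : ∀ a b → AtMostComponents (2 ℕ.+ r) ⟦ between a b ⟧
  between-components a b = reach-components λ p (q , q∈ , q∼p) →
    reach-via (path-∼ (q , q∈ , q∼p) (∼-sym {q} {p} q∼p))
      (climb {b = b} (λ {s} s∈ → s , s∈ , ∼-refl {s}) q q∈)

  -- Below a, walking down always reaches the root.
  outside-components : ∀ a b → AtMostComponents (2 ℕ.+ r) ⟦ outside a b ⟧
  outside-components a b = reach-components λ p (q , q∈ , q∼p) →
    reach-via (path-∼ (q , q∈ , q∼p) (∼-sym {q} {p} q∼p)) (Sum.[ lower q , upper q ]′ q∈)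
    where
    lower : ∀ q → height q ≤ a → Reach ⟦ outside a b ⟧ b q
    lower q h≤a = from-root (climb {a = 0#} {a} (λ {s} (_ , s≤a) → s , inj₁ s≤a , ∼-refl {s}) q
        (≤-trans (0≤ι (rank (proj₁ q))) (rank≤height q) , h≤a))
      where
      from-root : Reach ⟦ outside a b ⟧ 0# q → Reach ⟦ outside a b ⟧ b q
      from-root (at-root {q′} q′-root path) = at-root {q = q′} q′-root path
      from-root (stops f f<0 _ _ _)         = contradiction (0≤ι (rank f)) (<⇒≱ f<0)

    upper : ∀ q → b ≤ height q → Reach ⟦ outside a b ⟧ b q
    -- The height of `q` itself serves as the ceiling, as the walk never rises above its start.
    upper q b≤h = climb {b = height q} (λ {s} (b≤s , _) → s , inj₂ b≤s , ∼-refl {s}) q (b≤h , ≤-refl)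

mainTheorem5 :
    (∀ {ℓ} → ExcludedMiddle ℓ) →
    (ℝ : CompleteOrderedField) (G : Graph) →
    let open CompleteOrderedField ℝ
        open Cake ℝ G in
    Connected G → (r : ℕ) → IsRadius G r →
    (v-A v-B : Valuation) (t : Carrier) → 0# ≤ t → t ≤ 1# →
    ∃₂ λ (α β : BorelSet) →
      IsWeightedConsensusDivision v-A v-B t α β ×
      AtMostComponents (r ℕ.+ 2) ⟦ α ⟧ ×
      AtMostComponents (r ℕ.+ 2) ⟦ β ⟧
mainTheorem5 em ℝ G connected r radius v-A v-B t 0≤t t≤1 =
  divide (consensus-division rank<bound v-A v-B 0≤t t≤1)
  where
  layout : Layout G r
  layout = Layouts.layout em G connected r radius

  open Layout layout
  open CompleteOrderedField ℝ using (1#; _-_)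
  open Cake ℝ G
  open Divisions em ℝ G rank reversed
  open Components em ℝ G layout

  few : ∀ {α} → AtMostComponents (2 ℕ.+ r) α → AtMostComponents (r ℕ.+ 2) α
  few {α} = ≡.subst (λ k → AtMostComponents k α) (ℕ.+-comm 2 r)

  divide : (∃₂ λ a b → IsWeightedConsensusDivision v-A v-B t (between a b) (outside a b)
                     ⊎ IsWeightedConsensusDivision v-A v-B t (outside a b) (between a b)) →
           ∃₂ λ α β → IsWeightedConsensusDivision v-A v-B t α β ×
             AtMostComponents (r ℕ.+ 2) ⟦ α ⟧ × AtMostComponents (r ℕ.+ 2) ⟦ β ⟧
  divide (a , b , inj₁ division) = between a b , outside a b , division ,
    few (between-components a b) , few (outside-components a b)
  divide (a , b , inj₂ division) = outside a b , between a b , division ,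
    few (outside-components a b) , few (between-components a b)
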